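{- Let $T$ be a tree having $l$ leaves, $\beta$ branches that are endpoints of at least one end-path, and $b$ branches that are endpoints of at least two end-paths. If $P_1,P_2,\dots,P_b$ are the end-palms of $T$, then $$\chi_L(T)\leq 2-2b+\sum_{i=1}^b\chi_L(P_i)\leq l-\beta+2\leq l-b+2.$$
   Context: For a simple connected graph $G=(V,E)$, a $k$-coloring is a map $c:V\to\{1,\dots,k\}$ with adjacent vertices receiving different colors; $c^{ -1}(i)$ denotes the $i$-th color class, and $d(u,S)=\min_{v\in S}d(u,v)$. The color code of $v$ is $r_c(v)=(d(v,c^{ -1}(1)),\dots,d(v,c^{ -1}(k)))$. The coloring $c$ is a locating coloring if distinct vertices have distinct color codes. The locating chromatic number $\chi_L(G)$ is the least $k$ such that $G$ has a locating $k$-coloring. In a tree, a branch is a vertex of degree greater than two; an end-path is a path from a leaf to its nearest branch; an end-branch is a branch that is the endpoint of at least two end-paths; an end-palm is the subtree consisting of an end-branch together with all of its end-paths.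
   Formalization: The tree T is additionally assumed to have at least one branch (it is not a path); for a path on n ≥ 3 vertices b = 0 and the first inequality would read χ_L(T) ≤ 2, which is false since χ_L = 3. -}

module Defs where

open import Data.Nat using (ℕ; zero; suc; _+_; _≤_; _≥_)
open import Data.Fin using (Fin; zero; suc; fromℕ; inject₁)
open import Data.Bool using (Bool; true; false; T; if_then_else_)
open import Data.List using (List; map; allFin)
open import Data.Nat.ListAction using (sum)
open import Data.List.Membership.Propositional using (_∈_)
open import Data.List.Relation.Unary.Unique.Propositional using (Unique)
open import Data.Product using (Σ; ∃; _×_; _,_)
open import Data.Sum using (_⊎_)
open import Data.Unit using (⊤)
open import Relation.Nullary using (¬_)
open import Relation.Binary.PropositionalEquality using (_≡_; _≢_)

record Graph (n : ℕ) : Set where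
  field
    Adj     : Fin n → Fin n → Bool
    sym     : ∀ u v → T (Adj u v) → T (Adj v u)
    irrefl  : ∀ v → ¬ T (Adj v v)

open Graph public

VSet : ℕ → Set₁
VSet n = Fin n → Set

Full : ∀ {n} → VSet n
Full _ = ⊤

-- Walk of length k from u to v all of whose vertices lie in S
-- (i.e. a walk in the subgraph induced by S), as a vertex sequence.
WalkIn : ∀ {n} → Graph n → VSet n → Fin n → Fin n → ℕ → Set
WalkIn {n} G S u v k =
  Σ (Fin (suc k) → Fin n) λ p →
    (p zero ≡ u) × (p (fromℕ k) ≡ v) ×
    (∀ (i : Fin k) → T (Adj G (p (inject₁ i)) (p (suc i)))) ×
    (∀ (i : Fin (suc k)) → S (p i))

Walk : ∀ {n} → Graph n → Fin n → Fin n → ℕ → Set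
Walk G = WalkIn G Full

Dist : ∀ {n} → Graph n → Fin n → Fin n → ℕ → Set
Dist G u v k = Walk G u v k × (∀ m → Walk G u v m → k ≤ m)

IsPath : ∀ {n} → Graph n → Fin n → Fin n → (k : ℕ) → (Fin (suc k) → Fin n) → Set
IsPath {n} G u v k p =
    (p zero ≡ u) × (p (fromℕ k) ≡ v) ×
    (∀ (i : Fin k) → T (Adj G (p (inject₁ i)) (p (suc i)))) ×
    (∀ i j → p i ≡ p j → i ≡ j)

HasCycle : ∀ {n} → Graph n → Set
HasCycle {n} G =
  Σ ℕ λ m → Σ (Fin (suc m) → Fin n) λ p →
    (m ≥ 2) × IsPath G (p zero) (p (fromℕ m)) m p × T (Adj G (p (fromℕ m)) (p zero))

Connected : ∀ {n} → Graph n → Set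
Connected G = ∀ u v → ∃ λ k → Walk G u v k

IsTree : ∀ {n} → Graph n → Set
IsTree G = Connected G × ¬ HasCycle G

deg : ∀ {n} → Graph n → Fin n → ℕ
deg {n} G v = sum (map (λ w → if Adj G v w then 1 else 0) (allFin n))

Leaf : ∀ {n} → Graph n → Fin n → Set
Leaf G v = deg G v ≡ 1

Branch : ∀ {n} → Graph n → Fin n → Set
Branch G v = deg G v ≥ 3

NearestBranch : ∀ {n} → Graph n → Fin n → Fin n → Set
NearestBranch G x v =
  Branch G v × (∀ w k m → Branch G w → Dist G x v k → Dist G x w m → k ≤ m)

EndPath : ∀ {n} → Graph n → Fin n → Fin n → (k : ℕ) → (Fin (suc k) → Fin n) → Set
EndPath G x v k p = Leaf G x × NearestBranch G x v × IsPath G x v k p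

EndPathFromTo : ∀ {n} → Graph n → Fin n → Fin n → Set
EndPathFromTo {n} G x v = Σ ℕ λ k → Σ (Fin (suc k) → Fin n) λ p → EndPath G x v k p

HasEndPath : ∀ {n} → Graph n → Fin n → Set
HasEndPath G v = Branch G v × ∃ λ x → EndPathFromTo G x v

EndBranch : ∀ {n} → Graph n → Fin n → Set
EndBranch G v =
  Branch G v × Σ _ λ x → Σ _ λ y → x ≢ y × EndPathFromTo G x v × EndPathFromTo G y v

Palm : ∀ {n} → Graph n → Fin n → VSet n
Palm {n} G v u =
  (u ≡ v) ⊎
  (Σ (Fin n) λ x → Σ ℕ λ k → Σ (Fin (suc k) → Fin n) λ p →
     EndPath G x v k p × Σ (Fin (suc k)) λ j → p j ≡ u)

Proper : ∀ {n k} → Graph n → VSet n → (Fin n → Fin k) → Set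
Proper G S c = ∀ u v → S u → S v → T (Adj G u v) → c u ≢ c v

DistToClass : ∀ {n k} → Graph n → VSet n → (Fin n → Fin k) → Fin n → Fin k → ℕ → Set
DistToClass G S c u i d =
  (Σ _ λ w → S w × c w ≡ i × WalkIn G S u w d) ×
  (∀ w m → S w → c w ≡ i → WalkIn G S u w m → d ≤ m)

-- distinct vertices of S have distinct color codes
-- (equal codes: every coordinate distance of u is also that of v)
Locating : ∀ {n k} → Graph n → VSet n → (Fin n → Fin k) → Set
Locating {k = k} G S c =
  ∀ u v → S u → S v →
    (∀ (i : Fin k) d → DistToClass G S c u i d → DistToClass G S c v i d) → u ≡ v

HasLocatingColoring : ∀ {n} → Graph n → VSet n → ℕ → Set
HasLocatingColoring {n} G S k =
  Σ (Fin n → Fin k) λ c → Proper G S c × Locating G S c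

LocChromNum : ∀ {n} → Graph n → VSet n → ℕ → Set
LocChromNum G S k =
  HasLocatingColoring G S k × (∀ j → HasLocatingColoring G S j → k ≤ j)

Enumerates : ∀ {n} → List (Fin n) → (Fin n → Set) → Set
Enumerates xs P = Unique xs × (∀ x → (x ∈ xs → P x) × (P x → x ∈ xs))

{-# OPTIONS --safe #-}
module Submission where

-- Let d be the distance in T. An edge v w is a leg of the branch v if no branch lies on the side of w;
-- the palm of v is v with the sides of its legs. A side without end-branches contains no branch at
-- all, because beyond a farthest branch there are only legs.
--
-- First inequality. 2-colour the vertices outside all legs by parity. Colour each palm P by an optimal
-- colouring of its own: the colour of its centre v and the colour of one neighbour of v in P are
-- identified with the two parity colours, the others are kept private to P. Private colours exist, since
-- two colours cannot locate two neighbours of v. Distances inside P to the colours of P are unchanged in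
-- T, so vertices of one palm are separated. From outside the legs of v the private colours of v are
-- reached through v, so equal codes mean equal distances to v; hence vertices in different palms, or one
-- in a palm and one outside, are separated. Two vertices x, y outside the legs with equal codes have a
-- midpoint m such that neither the side of x nor that of y contains an end-branch, so both sides are legs
-- of m if m is a branch, and otherwise m has no neighbour left towards any end-branch.
--
-- Second inequality. A palm with k legs has a locating colouring with k + 1 colours: give colour 0 to even
-- depths and a colour of its own to the odd depths of each leg. Every leg ends in its own leaf.

open import Defs hiding (sym)
open import Data.Bool using (Bool; true; false; T; if_then_else_; not)
open import Data.Bool.Properties using (T?)
open import Data.Empty using (⊥)
open import Data.Fin using (Fin; zero; suc; fromℕ; fromℕ<; inject₁; toℕ; _≟_; join; splitAt; _↑ˡ_; _↑ʳ_; opposite; punchOut)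
open import Data.Fin.Properties using (any?; all?; toℕ-injective; toℕ<n; toℕ-fromℕ<; splitAt-join; splitAt-↑ˡ; splitAt-↑ʳ; ↑ˡ-injective; ↑ʳ-injective; punchOut-injective) renaming (suc-injective to Fin-suc-injective)
open import Data.List using (List; []; _∷_; _++_; length; map; allFin; filter)
open import Data.List.Membership.Propositional using (_∈_)
open import Data.List.Membership.Propositional.Properties using (∈-∃++; ∈-++⁻; ∈-++⁺ˡ; ∈-++⁺ʳ; ∈-filter⁺; ∈-filter⁻; ∈-allFin; ∈-map⁺)
open import Data.List.Membership.Propositional.Properties.WithK using (unique⇒irrelevant)
open import Data.List.Membership.Setoid.Properties using (index-injective)
open import Data.List.Properties using (length-map)
open import Data.List.Relation.Binary.Permutation.Propositional.Properties using (shift) renaming (map⁺ to ↭-map⁺)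
open import Data.List.Relation.Unary.All as All using ([]; _∷_)
open import Data.List.Relation.Unary.AllPairs using ([]; _∷_)
open import Data.List.Relation.Unary.Any using (here; there; index)
open import Data.List.Relation.Unary.Unique.Propositional using (Unique)
open import Data.List.Relation.Unary.Unique.Propositional.Properties using (allFin⁺; filter⁺)
open import Data.Nat using (ℕ; zero; suc; _+_; _*_; _∸_; _≤_; _<_; z≤n; s≤s; _≤?_) renaming (_≟_ to _≟ℕ_)
open import Data.Nat.ListAction using (sum)
open import Data.Nat.ListAction.Properties using (sum-↭)
open import Data.Nat.Properties hiding (_≟_)
open import Data.Nat.Tactic.RingSolver using (solve-∀)
open import Data.Product using (Σ; ∃; ∃₂; _×_; _,_; proj₁; proj₂)
open import Data.Sum using (_⊎_; inj₁; inj₂; [_,_]′)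
open import Data.Sum.Properties using (inj₁-injective; inj₂-injective)
open import Data.Unit using (tt)
open import Relation.Binary.PropositionalEquality using (_≡_; _≢_; refl; sym; trans; cong; cong₂; subst; subst₂; ≢-sym; setoid)
open import Relation.Nullary using (¬_; Dec; yes; no; does; contradiction)
open import Relation.Nullary.Decidable using (map′; _×-dec_; ¬?; _→-dec_; decidable-stable)
open import Relation.Unary using (Decidable)
import Data.List.Membership.DecPropositional as DecMembership

m+n≤m⇒n≡0 : ∀ {m n} → m + n ≤ m → n ≡ 0
m+n≤m⇒n≡0 {m} {n} le = n≤0⇒n≡0 (+-cancelˡ-≤ m n 0 (≤-trans le (≤-reflexive (sym (+-identityʳ m)))))

-- Finite extrema and finite counting

least : {P : ℕ → Set} → Decidable P → ∀ b → P b → ∃ λ k → P k × (∀ m → P m → k ≤ m)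
least P? zero p = zero , p , λ _ _ → z≤n
least {P} P? (suc b) p with P? 0
... | yes p₀ = 0 , p₀ , λ _ _ → z≤n
... | no ¬p₀ with k , pk , min ← least {λ k → P (suc k)} (λ k → P? (suc k)) b p =
  suc k , pk , λ { zero p₀ → contradiction p₀ ¬p₀ ; (suc m) pm → s≤s (min m pm) }

argmin : ∀ {n} {P : Fin n → Set} → Decidable P → (f : Fin n → ℕ) → ∃ P →
  ∃ λ x → P x × (∀ y → P y → f x ≤ f y)
argmin {P = P} P? f (x , px)
  with k , (y , py , refl) , min ←
    least {λ k → ∃ λ x → P x × f x ≡ k} (λ k → any? λ x → P? x ×-dec (f x ≟ℕ k)) (f x) (x , px , refl)
  = y , py , λ z pz → min (f z) (z , pz , refl)

bounded : ∀ {n} (f : Fin n → ℕ) → ∃ λ b → ∀ x → f x ≤ b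
bounded {zero}  f = 0 , λ ()
bounded {suc n} f with b , f≤b ← bounded (λ x → f (suc x)) =
  f zero + b , λ { zero → m≤m+n _ _ ; (suc x) → ≤-trans (f≤b x) (m≤n+m b (f zero)) }

argmax : ∀ {n} {P : Fin n → Set} → Decidable P → (f : Fin n → ℕ) → ∃ P →
  ∃ λ x → P x × (∀ y → P y → f y ≤ f x)
argmax P? f ∃P with b , f≤b ← bounded f with x , px , min ← argmin P? (λ x → b ∸ f x) ∃P =
  x , px , λ y py → ∸-cancelʳ-≤ (f≤b y) (min y py)

module _ {A : Set} where

  -- Delete one occurrence of the head of `xs` from `ys`; as `xs` has no repetitions, its tail still
  -- lies in what remains.
  sum-⊆ : (f : A → ℕ) {xs ys : List A} → Unique xs → (∀ {x} → x ∈ xs → x ∈ ys) →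
    sum (map f xs) ≤ sum (map f ys)
  sum-⊆ f [] sub = z≤n
  sum-⊆ f {x ∷ xs} (x≢ ∷ uq) sub with as , bs , refl ← ∈-∃++ (sub (here refl)) =
    subst (f x + sum (map f xs) ≤_) (sym (sum-↭ (↭-map⁺ f (shift x as bs))))
      (+-monoʳ-≤ (f x) (sum-⊆ f uq sub′))
    where
    sub′ : ∀ {y} → y ∈ xs → y ∈ as ++ bs
    sub′ y∈ with ∈-++⁻ as (sub (there y∈))
    ... | inj₁ y∈as = ∈-++⁺ˡ y∈as
    ... | inj₂ (here refl) = contradiction refl (All.lookup x≢ y∈)
    ... | inj₂ (there y∈bs) = ∈-++⁺ʳ as y∈bs

  sum-const : (c : ℕ) (xs : List A) → sum (map (λ _ → c) xs) ≡ length xs * c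
  sum-const c [] = refl
  sum-const c (x ∷ xs) = cong (c +_) (sum-const c xs)

  length-⊆ : {xs ys : List A} → Unique xs → (∀ {x} → x ∈ xs → x ∈ ys) → length xs ≤ length ys
  length-⊆ {xs} {ys} uq sub =
    subst₂ _≤_ (trans (sum-const 1 xs) (*-identityʳ _)) (trans (sum-const 1 ys) (*-identityʳ _)) (sum-⊆ (λ _ → 1) uq sub)

-- Neighbourhoods

module _ {n} (G : Graph n) where

  nbrs : Fin n → List (Fin n)
  nbrs v = filter (λ w → T? (Adj G v w)) (allFin n)

  deg≡length-nbrs : ∀ v → deg G v ≡ length (nbrs v)
  deg≡length-nbrs v = go (allFin n)
    where
    go : ∀ ws → sum (map (λ w → if Adj G v w then 1 else 0) ws) ≡ length (filter (λ w → T? (Adj G v w)) ws)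
    go [] = refl
    go (w ∷ ws) with Adj G v w
    ... | true  = cong suc (go ws)
    ... | false = go ws

  ∈-nbrs : ∀ {v w} → T (Adj G v w) → w ∈ nbrs v
  ∈-nbrs = ∈-filter⁺ (λ w → T? (Adj G _ w)) (∈-allFin _)

  nbrs-∈ : ∀ {v w} → w ∈ nbrs v → T (Adj G v w)
  nbrs-∈ w∈ = proj₂ (∈-filter⁻ (λ w → T? (Adj G _ w)) {xs = allFin n} w∈)

  deg≤ : ∀ v ws → (∀ w → T (Adj G v w) → w ∈ ws) → deg G v ≤ length ws
  deg≤ v ws sub = subst (_≤ length ws) (sym (deg≡length-nbrs v))
    (length-⊆ (filter⁺ _ (allFin⁺ n)) (λ w∈ → sub _ (nbrs-∈ w∈)))

  ≤deg : ∀ v {ws} → Unique ws → (∀ {w} → w ∈ ws → T (Adj G v w)) → length ws ≤ deg G v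
  ≤deg v {ws} uq sub = subst (length ws ≤_) (sym (deg≡length-nbrs v))
    (length-⊆ uq (λ w∈ → ∈-nbrs (sub w∈)))

  three-nbrs : ∀ {v a b c} → T (Adj G v a) → T (Adj G v b) → T (Adj G v c) →
    a ≢ b → a ≢ c → b ≢ c → Branch G v
  three-nbrs {v} va vb vc a≢b a≢c b≢c =
    ≤deg v ((a≢b ∷ a≢c ∷ []) ∷ (b≢c ∷ []) ∷ [] ∷ [])
      λ { (here refl) → va ; (there (here refl)) → vb ; (there (there (here refl))) → vc }

  two-nbrs : ∀ {v a b} → T (Adj G v a) → T (Adj G v b) → a ≢ b → 2 ≤ deg G v
  two-nbrs {v} va vb a≢b = ≤deg v ((a≢b ∷ []) ∷ [] ∷ [])
      λ { (here refl) → va ; (there (here refl)) → vb }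

  -- Otherwise all neighbours of `v` would be among `a` and `b`, giving degree at most two.
  third-nbr : ∀ {v} → Branch G v → ∀ a b → ∃ λ c → T (Adj G v c) × c ≢ a × c ≢ b
  third-nbr {v} br a b with any? (λ c → T? (Adj G v c) ×-dec (¬? (c ≟ a) ×-dec ¬? (c ≟ b)))
  ... | yes r = r
  ... | no ¬r = contradiction (≤-trans br (deg≤ v (a ∷ b ∷ []) sub)) λ { (s≤s (s≤s ())) }
    where
    sub : ∀ w → T (Adj G v w) → w ∈ a ∷ b ∷ []
    sub w vw with w ≟ a | w ≟ b
    ... | yes refl | _ = here refl
    ... | no _ | yes refl = there (here refl)
    ... | no w≢a | no w≢b = contradiction (w , vw , w≢a , w≢b) ¬r

  branch? : Decidable (Branch G)
  branch? v = 3 ≤? deg G v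

  leaf-not-branch : ∀ {v} → Leaf G v → ¬ Branch G v
  leaf-not-branch lf br with s≤s () ← ≤-trans br (≤-reflexive lf)

-- Walks and simple paths

module _ {n} (G : Graph n) where

  data Trail (S : VSet n) : Fin n → Fin n → ℕ → Set where
    here : ∀ {u} → S u → Trail S u u 0
    _∷⟨_⟩_ : ∀ {u w v k} → S u → T (Adj G u w) → Trail S w v k → Trail S u v (suc k)

  module _ {S : VSet n} where

    walk-cons : ∀ {u w v k} → S u → T (Adj G u w) → WalkIn G S w v k → WalkIn G S u v (suc k)
    walk-cons {u} su uw (p , refl , refl , adj , inS) =
      (λ { zero → u ; (suc i) → p i }) , refl , refl ,
      (λ { zero → uw ; (suc i) → adj i }) , (λ { zero → su ; (suc i) → inS i })

    toWalk : ∀ {u v k} → Trail S u v k → WalkIn G S u v k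
    toWalk (here su) = (λ _ → _) , refl , refl , (λ ()) , (λ _ → su)
    toWalk (su ∷⟨ uw ⟩ t) = walk-cons su uw (toWalk t)

    fromWalk : ∀ {u v} k → WalkIn G S u v k → Trail S u v k
    fromWalk zero (p , refl , refl , adj , inS) = here (inS zero)
    fromWalk (suc k) (p , refl , refl , adj , inS) =
      inS zero ∷⟨ adj zero ⟩ fromWalk k ((λ i → p (suc i)) , refl , refl , (λ i → adj (suc i)) , (λ i → inS (suc i)))

    infixr 5 _++ᵗ_
    _++ᵗ_ : ∀ {u v w k l} → Trail S u v k → Trail S v w l → Trail S u w (k + l)
    here _ ++ᵗ t = t
    (su ∷⟨ uw ⟩ s) ++ᵗ t = su ∷⟨ uw ⟩ (s ++ᵗ t)

    start : ∀ {u v k} → Trail S u v k → S u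
    start (here su) = su
    start (su ∷⟨ _ ⟩ _) = su

    reverseᵗ : ∀ {u v k} → Trail S u v k → Trail S v u k
    reverseᵗ (here su) = here su
    reverseᵗ {u} {v} (_∷⟨_⟩_ {w = w} {k = k} su uw t) =
      subst (Trail S v u) (+-comm k 1) (reverseᵗ t ++ᵗ (start t ∷⟨ Graph.sym G u w uw ⟩ here su))

    SimplePath : Fin n → Fin n → Set
    SimplePath u v = Σ ℕ λ k → Σ (Fin (suc k) → Fin n) λ p → IsPath G u v k p × (∀ i → S (p i))

    suffix : ∀ {u v} k (p : Fin (suc k) → Fin n) → IsPath G u v k p → (∀ i → S (p i)) →
      ∀ i → SimplePath (p i) v
    suffix k p (_ , e , adj , inj) inS zero = k , p , (refl , e , adj , inj) , inS
    suffix (suc k) p (_ , e , adj , inj) inS (suc i) =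
      suffix k (λ i → p (suc i)) (refl , e , (λ i → adj (suc i)) , λ i j eq → Fin-suc-injective (inj (suc i) (suc j) eq)) (λ i → inS (suc i)) i

    -- Erase loops from the tail first; if the head already occurs on the resulting path, restart
    -- from that occurrence.
    loop-erase : ∀ {u v k} → Trail S u v k → SimplePath u v
    loop-erase {u} (here su) = 0 , (λ _ → u) , (refl , refl , (λ ()) , λ { zero zero _ → refl }) , λ _ → su
    loop-erase {u} (su ∷⟨ uw ⟩ t) with loop-erase t
    ... | k , p , path@(refl , e , adj , inj) , inS with any? (λ i → p i ≟ u)
    ...   | yes (i , refl) = suffix k p path inS i
    ...   | no ¬on = suc k , q , (refl , e , (λ { zero → uw ; (suc i) → adj i }) , q-inj) , λ { zero → su ; (suc i) → inS i }
      where
      q : Fin (suc (suc k)) → Fin n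
      q zero = u
      q (suc i) = p i
      q-inj : ∀ i j → q i ≡ q j → i ≡ j
      q-inj zero zero _ = refl
      q-inj zero (suc j) eq = contradiction (j , sym eq) ¬on
      q-inj (suc i) zero eq = contradiction (i , eq) ¬on
      q-inj (suc i) (suc j) eq = cong suc (inj i j eq)

  trail? : ∀ k u v → Dec (Trail Full u v k)
  trail? zero u v = map′ (λ { refl → here tt }) (λ { (here _) → refl }) (u ≟ v)
  trail? (suc k) u v =
    map′ (λ { (w , uw , t) → tt ∷⟨ uw ⟩ t }) (λ { (_ ∷⟨ uw ⟩ t) → _ , uw , t })
      (any? λ w → T? (Adj G u w) ×-dec trail? k w v)

  widen : ∀ {S u v k} → Trail S u v k → Trail Full u v k
  widen (here _) = here tt
  widen (_ ∷⟨ uw ⟩ t) = tt ∷⟨ uw ⟩ widen t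

  -- After loop erasure, a trail of positive length joining two neighbours of `x` off `x` closes up
  -- through `x` to a cycle.
  acyclic⇒unique-nbr : ¬ HasCycle G → ∀ {x w₁ w₂ k} → T (Adj G x w₁) → T (Adj G x w₂) →
    Trail (_≢ x) w₁ w₂ k → w₁ ≡ w₂
  acyclic⇒unique-nbr acyclic {x} {w₁} {w₂} xw₁ xw₂ t with loop-erase t
  ... | zero , p , (refl , refl , _) , _ = refl
  ... | suc k , p , (refl , refl , adj , inj) , avoid =
    contradiction (suc (suc k) , q , s≤s (s≤s z≤n) , (refl , refl , q-adj , q-inj) , Graph.sym G _ _ xw₂) acyclic
    where
    q : Fin (3 + k) → Fin n
    q zero = x
    q (suc i) = p i
    q-adj : ∀ i → T (Adj G (q (inject₁ i)) (q (suc i)))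
    q-adj zero = xw₁
    q-adj (suc i) = adj i
    q-inj : ∀ i j → q i ≡ q j → i ≡ j
    q-inj zero zero _ = refl
    q-inj zero (suc j) eq = contradiction (sym eq) (avoid j)
    q-inj (suc i) zero eq = contradiction eq (avoid i)
    q-inj (suc i) (suc j) eq = cong suc (inj i j eq)

-- The metric of a tree

module Metric {n} (G : Graph n) (tree : IsTree G) where

  infix 4 _~_
  _~_ : Fin n → Fin n → Set
  u ~ v = T (Adj G u v)

  ~-sym : ∀ {u v} → u ~ v → v ~ u
  ~-sym = Graph.sym G _ _

  shortest : ∀ u v → ∃ λ k → Trail G Full u v k × (∀ m → Trail G Full u v m → k ≤ m)
  shortest u v with k , w ← proj₁ tree u v = least (λ k → trail? G k u v) k (fromWalk G k w)

  abstract
    -- Sealed so that the search for a shortest trail never unfolds; all later facts come from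
    -- `geodesic` and `d-min`.
    d : Fin n → Fin n → ℕ
    d u v = proj₁ (shortest u v)

    geodesic : ∀ u v → Trail G Full u v (d u v)
    geodesic u v = proj₁ (proj₂ (shortest u v))

    d-min : ∀ {S u v k} → Trail G S u v k → d u v ≤ k
    d-min t = proj₂ (proj₂ (shortest _ _)) _ (widen G t)

  d-refl : ∀ u → d u u ≡ 0
  d-refl u = n≤0⇒n≡0 (d-min (here {S = Full} tt))

  d-sym : ∀ u v → d u v ≡ d v u
  d-sym u v = ≤-antisym (d-min (reverseᵗ G (geodesic v u))) (d-min (reverseᵗ G (geodesic u v)))

  d-tri : ∀ u v w → d u w ≤ d u v + d v w
  d-tri u v w = d-min (_++ᵗ_ G (geodesic u v) (geodesic v w))

  d≡0 : ∀ {u v} → d u v ≡ 0 → u ≡ v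
  d≡0 {u} {v} eq with d u v | geodesic u v
  d≡0 refl | .0 | here _ = refl

  d≤1 : ∀ {u v} → u ~ v → d u v ≤ 1
  d≤1 uv = d-min (_∷⟨_⟩_ {S = Full} tt uv (here tt))

  d-step : ∀ {u w} v → u ~ w → d u v ≤ suc (d w v)
  d-step v uw = d-min (tt ∷⟨ uw ⟩ geodesic _ v)

  d-step′ : ∀ {u w} v → u ~ w → d v u ≤ suc (d v w)
  d-step′ v uw = subst₂ (λ a b → a ≤ suc b) (d-sym _ v) (d-sym _ v) (d-step v uw)

  0<d : ∀ {u v} → u ≢ v → 1 ≤ d u v
  0<d {u} {v} u≢v with d u v in eq
  ... | zero = contradiction (d≡0 eq) u≢v
  ... | suc _ = s≤s z≤n

  dist⇒d : ∀ {u v k} → Dist G u v k → k ≡ d u v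
  dist⇒d {u} {v} {k} (w , min) = ≤-antisym (min _ (toWalk G (geodesic u v))) (d-min {Full} (fromWalk G k w))

  next : ∀ {u v} → u ≢ v → ∃ λ w → u ~ w × d u v ≡ suc (d w v)
  next {u} {v} u≢v = go (d u v) refl (geodesic u v)
    where
    go : ∀ k → d u v ≡ k → Trail G Full u v k → ∃ λ w → u ~ w × d u v ≡ suc (d w v)
    go .0 _ (here _) = contradiction refl u≢v
    go (suc k) eq (_ ∷⟨ uw ⟩ t) = _ , uw , ≤-antisym (d-step v uw) (subst (suc (d _ v) ≤_) (sym eq) (s≤s (d-min t)))

  -- A geodesic from w to r avoids x, so two such neighbours of x would be joined off x.
  unique-nearer : ∀ {r x w₁ w₂} → x ~ w₁ → x ~ w₂ → d w₁ r ≤ d x r → d w₂ r ≤ d x r → w₁ ≡ w₂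
  unique-nearer {r} {x} {w₁} {w₂} xw₁ xw₂ le₁ le₂ =
    acyclic⇒unique-nbr G (proj₂ tree) xw₁ xw₂
      (_++ᵗ_ G (avoid _ refl le₁ (adj≢ xw₁)) (reverseᵗ G (avoid _ refl le₂ (adj≢ xw₂))))
    where
    adj≢ : ∀ {w} → x ~ w → w ≢ x
    adj≢ xw refl = irrefl G x xw
    avoid : ∀ k {w} → d w r ≡ k → d w r ≤ d x r → w ≢ x → Trail G (_≢ x) w r k
    avoid zero eq le w≢x with refl ← d≡0 eq = here w≢x
    avoid (suc k) {w} eq le w≢x with next {w} {r} (λ { refl → contradiction (trans (sym eq) (d-refl w)) λ () })
    ... | w′ , ww′ , eq′ = w≢x ∷⟨ ww′ ⟩ avoid k (suc-injective (trans (sym eq′) eq)) (<⇒≤ lt) λ { refl → <-irrefl refl lt }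
      where
      lt : d w′ r < d x r
      lt = ≤-trans (≤-reflexive (sym eq′)) le

  -- Trees are bipartite: if `w` is no farther from `r` than `x`, then `unique-nearer` identifies
  -- `w` with the first step from `x` towards `r`.
  adj-dist : ∀ {x w} → x ~ w → ∀ r → d x r ≡ suc (d w r) ⊎ d w r ≡ suc (d x r)
  adj-dist {x} {w} xw r with d w r ≤? d x r
  ... | no gt = inj₂ (≤-antisym (d-step r (~-sym xw)) (≰⇒> gt))
  ... | yes le with x ≟ r
  ...   | yes refl with refl ← d≡0 (n≤0⇒n≡0 (≤-trans le (≤-reflexive (d-refl x)))) = contradiction xw (irrefl G x)
  ...   | no x≢r with p , xp , eq ← next x≢r
          with refl ← unique-nearer xw xp le (≤-trans (n≤1+n _) (≤-reflexive (sym eq))) = inj₁ eq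

  -- x lies on the side of w of the edge v w.
  Side : Fin n → Fin n → Fin n → Set
  Side v w x = d v x ≡ suc (d w x)

  side? : ∀ v w x → Dec (Side v w x)
  side? v w x = d v x ≟ℕ suc (d w x)

  side-flip : ∀ {v w x} → v ~ w → ¬ Side v w x → Side w v x
  side-flip {x = x} vw ¬s with adj-dist vw x
  ... | inj₁ s = contradiction s ¬s
  ... | inj₂ s = s

  side-≢ : ∀ {v w} → ¬ Side v w v
  side-≢ {v} s = contradiction (trans (sym (d-refl v)) s) λ ()

  side-self : ∀ {v w} → v ~ w → Side v w w
  side-self {v} {w} vw with adj-dist vw w
  ... | inj₁ s = s
  ... | inj₂ s = contradiction (trans (sym (d-refl w)) s) λ ()

  side-unique : ∀ {v w w′ x} → v ~ w → v ~ w′ → Side v w x → Side v w′ x → w ≡ w′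
  side-unique vw vw′ s s′ = unique-nearer vw vw′
    (≤-trans (n≤1+n _) (≤-reflexive (sym s))) (≤-trans (n≤1+n _) (≤-reflexive (sym s′)))

  -- The definitions of the sides give `d a w ≡ d b v`. If `a ≢ w`, the step from `a` towards `w`
  -- and the step to `b` both lead no farther from `v`, so they coincide; but the first approaches
  -- `w` and the second moves away from it.
  crossing : ∀ {v w a b} → v ~ w → a ~ b → Side v w a → ¬ Side v w b → a ≡ w × b ≡ v
  crossing {v} {w} {a} {b} vw ab sa ¬sb = go (a ≟ w)
    where
    dav : d a v ≡ suc (d a w)
    dav = trans (d-sym a v) (trans sa (cong suc (d-sym w a)))
    dbw : d b w ≡ suc (d b v)
    dbw = trans (d-sym b w) (trans (side-flip vw ¬sb) (cong suc (d-sym v b)))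
    daw≡dbv : d a w ≡ d b v
    daw≡dbv with adj-dist ab w
    ... | inj₂ eq = sym (suc-injective (trans (sym dbw) eq))
    ... | inj₁ eq = contradiction
      (subst (_≤ suc (d b v)) (trans dav (cong suc (trans eq (cong suc dbw)))) (d-step v ab))
      (<⇒≱ (s≤s (m≤n+m (suc (d b v)) 1)))
    go : Dec (a ≡ w) → a ≡ w × b ≡ v
    go (yes refl) = refl , d≡0 (trans (sym daw≡dbv) (d-refl a))
    go (no a≢w) with a′ , aa′ , eq ← next a≢w with refl ← unique-nearer {v} ab aa′
          (≤-trans (n≤1+n _) (≤-reflexive (sym (trans dav (cong suc daw≡dbv)))))
          (≤-trans (d-step′ a′ vw) (≤-trans (≤-reflexive (sym eq)) (≤-trans (n≤1+n _) (≤-reflexive (sym dav)))))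
      = contradiction (trans dbw (cong suc (trans (sym daw≡dbv) eq))) (m≢1+n+m _ {1})

  -- Follow a geodesic from `x` to `y`: by `crossing` it can leave the side only along the edge from
  -- `w` to `v`.
  separation : ∀ {v w x y} → v ~ w → Side v w x → ¬ Side v w y → d x y ≡ d x v + d v y
  separation {v} {w} {x} {y} vw sx ¬sy = ≤-antisym (d-tri x v y) (go _ ≤-refl sx)
    where
    go : ∀ k {x} → d x y ≤ k → Side v w x → d x v + d v y ≤ k
    go k {x} le sx with next {x} {y} (λ { refl → ¬sy sx })
    go zero le sx | b , xb , eq = contradiction (trans (sym eq) (n≤0⇒n≡0 le)) λ ()
    go (suc k) {x} le sx | b , xb , eq with side? v w b | ≤-pred (subst (_≤ suc k) eq le)
    ... | yes sb | le′ = ≤-trans (+-monoˡ-≤ (d v y) (d-step v xb)) (s≤s (go k le′ sb))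
    ... | no ¬sb | le′ with refl , refl ← crossing vw xb sx ¬sb = +-mono-≤ (d≤1 xb) le′

  -- Legs

  Leg : Fin n → Fin n → Set
  Leg v w = v ~ w × (∀ z → Side v w z → ¬ Branch G z)

  leg? : ∀ v w → Dec (Leg v w)
  leg? v w = T? (Adj G v w) ×-dec all? (λ z → side? v w z →-dec ¬? (branch? G z))

  nearer-inside : ∀ {v w a p} → v ~ w → Side v w a → a ~ p → a ≢ w → Side v w p
  nearer-inside {v} {w} {a} {p} vw sa ap a≢w =
    decidable-stable (side? v w p) λ ¬sp → a≢w (proj₁ (crossing vw ap sa ¬sp))

  -- By induction on depth, two different vertices of equal depth would share a parent. With its own
  -- step towards `v`, that parent would have three neighbours, and a leg contains no branch.
  leg-depth-injective : ∀ {v w a b} → Leg v w → Side v w a → Side v w b → d v a ≡ d v b → a ≡ b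
  leg-depth-injective {v} {w} (vw , leg) sa sb eq =
    go _ refl (suc-injective (trans (sym sb) (trans (sym eq) sa))) sa sb
    where
    go : ∀ k {a b} → d w a ≡ k → d w b ≡ k → Side v w a → Side v w b → a ≡ b
    go zero ea eb _ _ = trans (sym (d≡0 ea)) (d≡0 eb)
    go (suc k) {a} {b} ea eb sa sb = decidable-stable (a ≟ b) λ a≢b → clash a≢b
      where
      ≢w : ∀ {c} → d w c ≡ suc k → c ≢ w
      ≢w ec refl = contradiction (trans (sym ec) (d-refl w)) λ ()
      parent : ∀ {c} → d w c ≡ suc k → Side v w c → ∃ λ p → c ~ p × d w p ≡ k × Side v w p
      parent {c} ec sc with p , cp , e ← next (≢w ec) =
        p , cp , suc-injective (trans (cong suc (d-sym w p)) (trans (sym e) (trans (d-sym c w) ec))) , nearer-inside vw sc cp (≢w ec)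
      deeper : ∀ {c} → d w c ≡ suc k → Side v w c → d v c ≡ 2 + k
      deeper ec sc = trans sc (cong suc ec)
      clash : a ≢ b → ⊥
      clash a≢b with p , ap , ep , sp ← parent ea sa | q , bq , eq , sq ← parent eb sb
        with refl ← go k ep eq sp sq
        with r , pr , er ← next {p} {v} (λ { refl → side-≢ sp }) =
        leg p sp (three-nbrs G (~-sym ap) (~-sym bq) pr a≢b (≢r (deeper ea sa)) (≢r (deeper eb sb)))
        where
        ≢r : ∀ {c} → d v c ≡ 2 + k → c ≢ r
        ≢r ec refl = m≢1+n+m (d v r) {1} (trans ec (cong suc (trans (sym (trans sp (cong suc ep))) (trans (d-sym v p) (trans er (cong suc (d-sym r v)))))))

  path-prefix : ∀ k (p : Fin (suc k) → Fin n) → (∀ i → p (inject₁ i) ~ p (suc i)) →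
    ∀ i → d (p zero) (p i) ≤ toℕ i
  path-prefix k p adj zero = ≤-reflexive (d-refl (p zero))
  path-prefix (suc k) p adj (suc i) =
    ≤-trans (d-step (p (suc i)) (adj zero)) (s≤s (path-prefix k (λ i → p (suc i)) (λ i → adj (suc i)) i))

  path-suffix : ∀ k (p : Fin (suc k) → Fin n) → (∀ i → p (inject₁ i) ~ p (suc i)) →
    ∀ i → toℕ i + d (p i) (p (fromℕ k)) ≤ k
  path-suffix zero p adj zero = ≤-reflexive (d-refl (p zero))
  path-suffix (suc k) p adj zero =
    ≤-trans (d-step _ (adj zero)) (s≤s (path-suffix k (λ i → p (suc i)) (λ i → adj (suc i)) zero))
  path-suffix (suc k) p adj (suc i) = s≤s (path-suffix k (λ i → p (suc i)) (λ i → adj (suc i)) i)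

  module _ {k} (p : Fin (suc k) → Fin n) (adj : ∀ i → p (inject₁ i) ~ p (suc i))
           (geo : d (p zero) (p (fromℕ k)) ≡ k) where

    geodesic-prefix : ∀ i → d (p zero) (p i) ≡ toℕ i
    geodesic-prefix i = ≤-antisym (path-prefix k p adj i)
      (+-cancelʳ-≤ (d (p i) (p (fromℕ k))) _ _
        (≤-trans (path-suffix k p adj i) (≤-trans (≤-reflexive (sym geo)) (d-tri _ (p i) _))))

    geodesic-suffix : ∀ i → toℕ i + d (p i) (p (fromℕ k)) ≡ k
    geodesic-suffix i = ≤-antisym (path-suffix k p adj i)
      (≤-trans (≤-reflexive (sym geo)) (≤-trans (d-tri _ (p i) _) (+-monoˡ-≤ _ (path-prefix k p adj i))))

    geodesic-injective : ∀ i j → p i ≡ p j → i ≡ j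
    geodesic-injective i j eq =
      toℕ-injective (trans (sym (geodesic-prefix i)) (trans (cong (d (p zero)) eq) (geodesic-prefix j)))

  -- A simple path in a tree keeps moving away from its start. In `away` the reference point `r`
  -- stays fixed while the path is shortened from the front.
  simple⇒geodesic : ∀ {u v} k (p : Fin (suc k) → Fin n) → IsPath G u v k p → d u v ≡ k
  simple⇒geodesic zero p (refl , refl , _) = d-refl (p zero)
  simple⇒geodesic (suc k) p (refl , refl , adj , inj) =
    trans (away k p adj inj (p zero) away₀) (cong (_+ suc k) (d-refl (p zero)))
    where
    away₀ : d (p zero) (p (suc zero)) ≡ suc (d (p zero) (p zero))
    away₀ with adj-dist (adj zero) (p zero)
    ... | inj₁ eq = contradiction (trans (sym (d-refl (p zero))) eq) λ ()
    ... | inj₂ eq = trans (d-sym _ _) eq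
    away : ∀ k (p : Fin (2 + k) → Fin n) → (∀ i → p (inject₁ i) ~ p (suc i)) →
      (∀ i j → p i ≡ p j → i ≡ j) → ∀ r → d r (p (suc zero)) ≡ suc (d r (p zero)) →
      d r (p (fromℕ (suc k))) ≡ d r (p zero) + suc k
    away zero p adj inj r eq = trans eq (+-comm 1 _)
    away (suc k) p adj inj r eq =
      trans (away k (λ i → p (suc i)) (λ i → adj (suc i))
              (λ i j e → Fin-suc-injective (inj (suc i) (suc j) e)) r onward)
        (trans (cong (_+ suc k) eq) (sym (+-suc _ (suc k))))
      where
      onward : d r (p (suc (suc zero))) ≡ suc (d r (p (suc zero)))
      onward with adj-dist (adj (suc zero)) r
      ... | inj₂ e = trans (d-sym _ _) (trans e (cong suc (d-sym _ _)))
      -- A step back towards `r` would lead to the same nearer neighbour as the previous vertex,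
      -- contradicting injectivity.
      ... | inj₁ e with () ← inj zero (suc (suc zero)) (unique-nearer (~-sym (adj zero)) (adj (suc zero))
              (≤-trans (n≤1+n _) (≤-reflexive (sym (trans (d-sym _ r) (trans eq (cong suc (d-sym r _)))))))
              (≤-trans (n≤1+n _) (≤-reflexive (sym e))))

-- Legs, end-paths, end-branches and palms

module Legs {n} (G : Graph n) (tree : IsTree G) where

  open Metric G tree

  OnLeg : Fin n → Fin n → Set
  OnLeg v u = ∃ λ w → Leg v w × Side v w u

  onLeg? : ∀ v u → Dec (OnLeg v u)
  onLeg? v u = any? λ w → leg? v w ×-dec side? v w u

  onLeg-not-branch : ∀ {v u} → OnLeg v u → ¬ Branch G u
  onLeg-not-branch (_ , (_ , nb) , s) = nb _ s

  d-dist : ∀ u v → Dist G u v (d u v)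
  d-dist u v = toWalk G (geodesic u v) , λ m w → d-min {Full} (fromWalk G m w)

  abstract
    -- A deepest vertex of the leg has only its parent as neighbour, so it is a leaf. Every branch
    -- lies off the leg, hence at or beyond `v`, and the geodesic to `v` meets every depth, thus
    -- every vertex of the leg.
    leg-end-path : ∀ {v w} → Branch G v → Leg v w → ∃ λ ℓ → Leaf G ℓ × Side v w ℓ ×
      Σ ℕ λ k → Σ (Fin (suc k) → Fin n) λ p → EndPath G ℓ v k p × (∀ u → Side v w u → ∃ λ j → p j ≡ u)
    leg-end-path {v} {w} br leg@(vw , nb) with argmax (side? v w) (d v) (w , side-self vw)
    ... | ℓ , sℓ , deepest with next {ℓ} {v} (λ { refl → side-≢ sℓ })
    ...   | q , ℓq , eq = ℓ , leaf , sℓ , from-walk (toWalk G (geodesic ℓ v))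
      where
      only-q : ∀ z → ℓ ~ z → z ∈ q ∷ []
      only-q z ℓz with adj-dist ℓz v
      ... | inj₁ e = here (side-unique ℓz ℓq e eq)
      ... | inj₂ e with side? v w z
      ...   | yes sz = contradiction (deepest z sz)
                (<⇒≱ (≤-reflexive (trans (cong suc (d-sym v ℓ)) (trans (sym e) (d-sym z v)))))
      ...   | no ¬sz with refl , refl ← crossing vw ℓz sℓ ¬sz = contradiction (trans (sym (d-refl v)) e) λ ()
      leaf : Leaf G ℓ
      leaf = ≤-antisym (deg≤ G ℓ (q ∷ []) only-q) (≤deg G ℓ ([] ∷ []) λ { (here refl) → ℓq })
      nearest : NearestBranch G ℓ v
      nearest = br , λ w′ k m br′ Dv Dw′ → subst₂ _≤_ (sym (dist⇒d Dv))
        (sym (trans (dist⇒d Dw′) (separation vw sℓ (λ s → nb w′ s br′)))) (m≤m+n _ _)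
      from-walk : Walk G ℓ v (d ℓ v) → Σ ℕ λ k → Σ (Fin (suc k) → Fin n) λ p →
        EndPath G ℓ v k p × (∀ u → Side v w u → ∃ λ j → p j ≡ u)
      from-walk (p , e₀ , eₖ , adj , _) =
        d ℓ v , p , (leaf , nearest , e₀ , eₖ , adj , geodesic-injective p adj geo) , cover
        where
        geo : d (p zero) (p (fromℕ (d ℓ v))) ≡ d ℓ v
        geo = cong₂ d e₀ eₖ
        cover : ∀ u → Side v w u → ∃ λ j → p j ≡ u
        cover u su = i , leg-depth-injective leg inside su (trans (d-sym v (p i)) depth)
          where
          depth≤ : d v u ≤ d ℓ v
          depth≤ = ≤-trans (deepest u su) (≤-reflexive (d-sym v ℓ))
          lt : d ℓ v ∸ d v u < suc (d ℓ v)
          lt = s≤s (m∸n≤m _ (d v u))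
          -- The path starts at the deepest vertex, so the vertex of depth `d v u` comes after
          -- `d ℓ v ∸ d v u` steps.
          i : Fin (suc (d ℓ v))
          i = fromℕ< lt
          depth : d (p i) v ≡ d v u
          depth = +-cancelˡ-≡ (d ℓ v ∸ d v u) _ _
            (trans (cong₂ _+_ (sym (toℕ-fromℕ< lt)) (cong (d (p i)) (sym eₖ)))
              (trans (geodesic-suffix p adj geo i) (sym (m∸n+n≡m depth≤))))
          -- Off the leg, `p i` would be `d v (p i)` farther from `ℓ` than `v` is, yet the path has
          -- at most `d ℓ v` steps; so it would have depth zero, while `u` has positive depth.
          inside : Side v w (p i)
          inside = decidable-stable (side? v w (p i)) λ ¬s → contradiction
            (trans (sym (m+n≤m⇒n≡0 (≤-trans (≤-reflexive (sym (separation vw sℓ ¬s)))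
                (≤-trans (≤-reflexive (cong (λ x → d x (p i)) (sym e₀)))
                  (≤-trans (path-prefix _ p adj i) (≤-pred (toℕ<n i)))))))
              (trans (d-sym v (p i)) (trans depth su)))
            λ ()

  two-legs⇒end-branch : ∀ {v a b} → Branch G v → Leg v a → Leg v b → a ≢ b → EndBranch G v
  two-legs⇒end-branch br la lb a≢b
    with ℓ , _ , sℓ , k , p , ep , _ ← leg-end-path br la | ℓ′ , _ , sℓ′ , k′ , p′ , ep′ , _ ← leg-end-path br lb =
    br , ℓ , ℓ′ , (λ { refl → a≢b (side-unique (proj₁ la) (proj₁ lb) sℓ sℓ′) }) , (k , p , ep) , (k′ , p′ , ep′)

  -- The converse of `leg-end-path`. The side of `v` containing `ℓ` consists of vertices between `ℓ`
  -- and `v`, since a place where it forked off would be a branch nearer to `ℓ` than `v`.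
  end-path-leg : ∀ {ℓ v k p} → EndPath G ℓ v k p →
    ∃ λ w → Leg v w × Side v w ℓ × (∀ z → Side v w z → d v z ≤ d v ℓ) × (∀ j → p j ≡ v ⊎ Side v w (p j))
  end-path-leg {ℓ} {v} {k} {p} (lf , (br , near) , path@(refl , refl , adj , _))
    with next {v} {ℓ} (λ { eq → leaf-not-branch G lf (subst (Branch G) eq br) })
  ... | w , vw , sℓ = w , (vw , no-branch) , sℓ , deepest , on-path
    where
    geo : d ℓ v ≡ k
    geo = simple⇒geodesic k p path
    closer : ∀ {z} → Branch G z → d ℓ z + d z v ≡ d ℓ v → z ≡ v
    closer {z} brz e = d≡0 (m+n≤m⇒n≡0 (≤-trans (≤-reflexive e) (near z _ _ brz (d-dist ℓ v) (d-dist ℓ z))))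
    -- Induction on the distance from `w`. The parent `q` of `z` lies between `ℓ` and `v`. If `z`
    -- leads away from `ℓ`, then either `q` is the leaf `ℓ` with two neighbours, or `q` is a branch
    -- with neighbours `z`, `r` towards `v` and `s` towards `ℓ`.
    between : ∀ j z → d w z ≡ j → Side v w z → d ℓ z + d z v ≡ d ℓ v
    between zero z e sz with refl ← d≡0 e =
      trans (cong₂ _+_ (d-sym ℓ w) (trans (d-sym w v) (trans sz (cong suc e))))
        (trans (+-comm _ 1) (trans (sym sℓ) (d-sym v ℓ)))
    between (suc j) z e sz = conclude (adj-dist (~-sym zq) ℓ)
      where
      z≢w : z ≢ w
      z≢w refl = contradiction (trans (sym e) (d-refl w)) λ ()
      down = next z≢w
      q = proj₁ down
      zq : z ~ q
      zq = proj₁ (proj₂ down)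
      sq : Side v w q
      sq = nearer-inside vw sz zq z≢w
      dwz : d w z ≡ suc (d w q)
      dwz = trans (d-sym w z) (trans (proj₂ (proj₂ down)) (cong suc (d-sym q w)))
      dzv : d z v ≡ suc (d q v)
      dzv = trans (d-sym z v) (trans sz (cong suc (trans dwz (trans (sym sq) (d-sym v q)))))
      onq : d ℓ q + d q v ≡ d ℓ v
      onq = between j q (suc-injective (trans (sym dwz) e)) sq
      q≢v : q ≢ v
      q≢v q≡v = side-≢ (subst (Side v w) q≡v sq)
      up = next q≢v
      r = proj₁ up
      qr : q ~ r
      qr = proj₁ (proj₂ up)
      dqv : d q v ≡ suc (d r v)
      dqv = proj₂ (proj₂ up)
      z≢r : z ≢ r
      z≢r z≡r = m≢1+n+m (d z v) {1} (trans dzv (cong suc (trans dqv (cong (λ x → suc (d x v)) (sym z≡r)))))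
      conclude : d q ℓ ≡ suc (d z ℓ) ⊎ d z ℓ ≡ suc (d q ℓ) → d ℓ z + d z v ≡ d ℓ v
      conclude (inj₁ nearer) = trans (cong (d ℓ z +_) dzv) (trans (+-suc _ _)
        (trans (cong (_+ d q v) (trans (cong suc (d-sym ℓ z)) (trans (sym nearer) (d-sym q ℓ)))) onq))
      conclude (inj₂ farther) with q ≟ ℓ
      ... | yes q≡ℓ = contradiction (≤-reflexive (trans (cong (deg G) q≡ℓ) lf)) (<⇒≱ (two-nbrs G (~-sym zq) qr z≢r))
      ... | no q≢ℓ with s , qs , dqℓ ← next q≢ℓ =
        contradiction (closer (three-nbrs G (~-sym zq) qr qs z≢r z≢s r≢s) onq) q≢v
        where
        z≢s : z ≢ s
        z≢s z≡s = m≢1+n+m (d z ℓ) {1} (trans farther (cong suc (trans dqℓ (cong (λ x → suc (d x ℓ)) (sym z≡s)))))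
        r≢s : r ≢ s
        r≢s r≡s = <⇒≱ (n<1+n (suc (d ℓ v)))
          (≤-trans (s≤s (s≤s (d-tri ℓ r v))) (≤-trans (≤-reflexive shorter) (n≤1+n (d ℓ v))))
          where
          shorter : suc (suc (d ℓ r + d r v)) ≡ d ℓ v
          shorter = trans (cong suc (sym (+-suc (d ℓ r) (d r v))))
            (trans (cong₂ _+_ (trans (cong (λ x → suc (d ℓ x)) r≡s)
              (trans (cong suc (d-sym ℓ s)) (trans (sym dqℓ) (d-sym q ℓ)))) (sym dqv)) onq)
    deepest : ∀ z → Side v w z → d v z ≤ d v ℓ
    deepest z sz = subst₂ _≤_ (d-sym z v) (d-sym ℓ v) (≤-trans (m≤n+m _ (d ℓ z)) (≤-reflexive (between _ z refl sz)))
    no-branch : ∀ z → Side v w z → ¬ Branch G z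
    no-branch z sz brz with refl ← closer brz (between _ z refl sz) = side-≢ sz
    on-path : ∀ j → p j ≡ v ⊎ Side v w (p j)
    on-path j with side? v w (p j)
    ... | yes s = inj₂ s
    ... | no ¬s = inj₁ (sym (d≡0 (m+n≤m⇒n≡0 (≤-trans (≤-reflexive (trans (cong (_+ d v (p j)) (sym geo)) (sym (separation vw sℓ ¬s))))
        (≤-trans (path-prefix k p adj j) (≤-pred (toℕ<n j)))))))

  -- A branch farthest from m on such a side would only have legs beyond it.
  end-branch-free⇒leg : ∀ {m x} → m ~ x → (∀ e → EndBranch G e → ¬ Side m x e) → Leg m x
  end-branch-free⇒leg {m} {x} mx free = mx , λ z sz brz → absurd (argmax branch-side? (d m) (z , sz , brz))
    where
    branch-side? : Decidable (λ z → Side m x z × Branch G z)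
    branch-side? z = side? m x z ×-dec branch? G z
    absurd : ¬ (∃ λ z → (Side m x z × Branch G z) × (∀ y → Side m x y × Branch G y → d m y ≤ d m z))
    absurd (z , (sz , br) , farthest) with next {z} {m} (λ { refl → side-≢ sz })
    ... | q , zq , eq
      with a , za , a≢q , _ ← third-nbr G br q q
      with b , zb , b≢q , b≢a ← third-nbr G br q a
      = free z (two-legs⇒end-branch br (beyond za a≢q) (beyond zb b≢q) (≢-sym b≢a)) sz
      where
      -- Any branch `t` behind such a `c` has `d t m ≡ d t z + d z m`, so maximality of `z` forces
      -- `t ≡ z`.
      beyond : ∀ {c} → z ~ c → c ≢ q → Leg z c
      beyond {c} zc c≢q = zc , λ t st brt → side-≢ (subst (Side z c) (t≡z t st brt) st)
        where
        ¬sm : ¬ Side z c m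
        ¬sm s = c≢q (side-unique zc zq s eq)
        t≡z : ∀ t → Side z c t → Branch G t → t ≡ z
        t≡z t st brt = d≡0 (m+n≤m⇒n≡0 (≤-trans (≤-reflexive (trans (+-comm (d z m) (d t z)) (sym dtm)))
                         (≤-trans (≤-reflexive (d-sym t m)) (≤-trans (farthest t (inside , brt)) (≤-reflexive (d-sym m z))))))
          where
          dtm : d t m ≡ d t z + d z m
          dtm = separation zc st ¬sm
          -- Otherwise the path from `z` to `t` would pass through `m`, and `z` also lies between
          -- `t` and `m`; this forces `z ≡ m`.
          inside : Side m x t
          inside = decidable-stable (side? m x t) λ ¬s → side-≢ (subst (Side m x) (d≡0 (m+n≡0⇒n≡0 (d z m)
            (m+n≤m⇒n≡0 {d z t} (≤-reflexive (sym (trans (separation mx sz ¬s)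
              (trans (cong (d z m +_) (trans (d-sym m t) (trans dtm (cong (_+ d z m) (d-sym t z)))))
                 (trans (+-comm (d z m) _) (+-assoc (d z t) (d z m) (d z m))))))))) ) sz)

  -- Without end-branches every side is a leg, which makes `v` itself an end-branch. The negative
  -- form suffices for `some-end-branch`, where membership in `bs` is decided.
  end-branch-exists : ∀ {v} → Branch G v → ¬ (∀ e → ¬ EndBranch G e)
  end-branch-exists {v} br none
    with a , va , _ ← third-nbr G br v v with b , vb , b≢a , _ ← third-nbr G br a a =
    none v (two-legs⇒end-branch br (end-branch-free⇒leg va (λ e eb _ → none e eb))
      (end-branch-free⇒leg vb (λ e eb _ → none e eb)) (≢-sym b≢a))

  -- Together with `onLeg⇒palm`, this replaces end-paths by legs, whose membership is decidable and
  -- metric.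
  palm⇒ : ∀ {v u} → Palm G v u → u ≡ v ⊎ OnLeg v u
  palm⇒ (inj₁ u≡v) = inj₁ u≡v
  palm⇒ (inj₂ (_ , _ , _ , ep , j , refl)) with w , leg , _ , _ , on ← end-path-leg ep with on j
  ... | inj₁ e = inj₁ e
  ... | inj₂ s = inj₂ (w , leg , s)

  onLeg⇒palm : ∀ {v u} → Branch G v → OnLeg v u → Palm G v u
  onLeg⇒palm br (w , leg , s) with ℓ , _ , _ , k , p , ep , cover ← leg-end-path br leg =
    inj₂ (ℓ , k , p , ep , cover _ s)

  palm? : ∀ {v} → Branch G v → Decidable (Palm G v)
  palm? {v} br u with u ≟ v | onLeg? v u
  ... | yes e | _ = yes (inj₁ e)
  ... | no _ | yes o = yes (onLeg⇒palm br o)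
  ... | no u≢v | no ¬o = no λ pu → [ u≢v , ¬o ]′ (palm⇒ pu)

  onLeg-separation : ∀ {v u t} → OnLeg v u → ¬ OnLeg v t → d u t ≡ d u v + d v t
  onLeg-separation (w , leg , s) ¬o = separation (proj₁ leg) s (λ st → ¬o (w , leg , st))

  -- A branch is never on a leg, so each of `v` and `v′` would lie between `u` and the other one.
  onLeg-owner : ∀ {v v′ u} → Branch G v → Branch G v′ → OnLeg v u → OnLeg v′ u → v ≡ v′
  onLeg-owner {v} {v′} {u} br br′ o o′ = d≡0 (m+n≡0⇒m≡0 (d v v′) (m+n≤m⇒n≡0 {d u v} (≤-reflexive (sym
    (trans (onLeg-separation o′ (λ p → onLeg-not-branch p br))
      (trans (cong (_+ d v′ v) (onLeg-separation o (λ p → onLeg-not-branch p br′))) (+-assoc (d u v) _ _)))))))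

  onLeg-nbr : ∀ {v u t} → OnLeg v u → u ~ t → t ≡ v ⊎ OnLeg v t
  onLeg-nbr {v} {u} {t} (w , leg , s) ut with side? v w t
  ... | yes st = inj₂ (w , leg , st)
  ... | no ¬st = inj₁ (proj₂ (crossing (proj₁ leg) ut s ¬st))

  -- Two end-paths along one leg would both start at its deepest vertex, so their leaves would
  -- coincide.
  end-branch-legs : ∀ {v} → EndBranch G v → ∃₂ λ a b → a ≢ b × Leg v a × Leg v b
  end-branch-legs {v} (br , x , y , x≢y , (_ , _ , ex) , (_ , _ , ey))
    with a , la , sx , deepx , _ ← end-path-leg ex | b , lb , sy , deepy , _ ← end-path-leg ey =
    a , b , (λ { refl → x≢y (leg-depth-injective la sx sy (≤-antisym (deepy x sx) (deepx y sy))) }) , la , lb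

-- Colour codes

module Codes {n} (G : Graph n) (tree : IsTree G) where

  open Metric G tree
  open Legs G tree

  -- Geodesic convexity: distances in the subgraph induced by `S` are then given by `d`.
  Closed : VSet n → Set
  Closed S = ∀ {x y} → S x → S y → Trail G S x y (d x y)

  -- Coordinatewise comparison of codes: `u′` is at most as far as `u` from every colour that occurs
  -- in `S`.
  Dominates : ∀ {k} → VSet n → (Fin n → Fin k) → Fin n → Fin n → Set
  Dominates S c u u′ = ∀ t → S t → ∃ λ t′ → S t′ × c t′ ≡ c t × d u′ t′ ≤ d u t

  -- Mutual domination is equality of colour codes, stated without the minima.
  Separates : ∀ {k} → VSet n → (Fin n → Fin k) → Set
  Separates S c = ∀ {u u′} → S u → S u′ → Dominates S c u u′ → Dominates S c u′ u → u ≡ u′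

  module _ {S : VSet n} (closed : Closed S) {k} {c : Fin n → Fin k} where

    locating⇒separates : Locating G S c → Separates S c
    locating⇒separates loc {u} {u′} su su′ dom dom′ = loc u u′ su su′ transfer
      where
      transfer : ∀ i δ → DistToClass G S c u i δ → DistToClass G S c u′ i δ
      transfer i δ ((t , st , refl , wk) , min) with t′ , st′ , ct′ , le ← dom t st =
        (t′ , st′ , ct′ , subst (WalkIn G S u′ t′) (≤-antisym le′ (lower t′ st′ ct′)) (toWalk G (closed su′ st′))) ,
        λ w m sw cw wk′ → ≤-trans (lower w sw cw) (d-min {S} (fromWalk G m wk′))
        where
        le′ : d u′ t′ ≤ δ
        le′ = ≤-trans le (d-min {S} (fromWalk G δ wk))
        lower : ∀ w → S w → c w ≡ c t → δ ≤ d u′ w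
        lower w sw cw with w′ , sw′ , cw′ , le″ ← dom′ w sw =
          ≤-trans (min w′ _ sw′ (trans cw′ cw) (toWalk G (closed su sw′))) le″

    separates⇒locating : Decidable S → Separates S c → Locating G S c
    separates⇒locating S? sep u u′ su su′ same = sep su su′ dom dom′
      where
      nearest : ∀ t → S t → ∃ λ x → S x × c x ≡ c t × d u x ≤ d u t × DistToClass G S c u (c t) (d u x)
      nearest t st with argmin (λ x → S? x ×-dec (c x ≟ c t)) (d u) (t , st , refl)
      ... | x , (sx , cx) , min = x , sx , cx , min t (st , refl) ,
        (x , sx , cx , toWalk G (closed su sx)) ,
        λ w m sw cw wk → ≤-trans (min w (sw , cw)) (d-min {S} (fromWalk G m wk))
      dom : Dominates S c u u′
      dom t st with x , sx , cx , le , dtc ← nearest t st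
        with (t′ , st′ , ct′ , wk) , _ ← same (c t) (d u x) dtc =
        t′ , st′ , ct′ , ≤-trans (d-min {S} (fromWalk G _ wk)) le
      -- Although `same` goes from `u` to `u′` only, the transferred coordinate is also a lower
      -- bound at `u′`, which gives the reverse comparison.
      dom′ : Dominates S c u′ u
      dom′ t st with x , sx , cx , _ , dtc ← nearest t st
        with _ , min ← same (c t) (d u x) dtc =
        x , sx , cx , min t _ st refl (toWalk G (closed su′ st))

  full-closed : Closed Full
  full-closed _ _ = geodesic _ _

  -- A step from a leg stays on legs of `v` or reaches `v`; a geodesic step out of `v` enters the
  -- leg containing the target.
  palm-closed : ∀ {v} → Branch G v → Closed (Palm G v)
  palm-closed {v} br {x} {y} = go _ refl
    where
    onward : ∀ {x y b} → Palm G v x → Palm G v y → x ~ b → d x y ≡ suc (d b y) → Palm G v b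
    onward px py xb eq with palm⇒ px
    ... | inj₂ o with onLeg-nbr o xb
    ...   | inj₁ b≡v = inj₁ b≡v
    ...   | inj₂ o′ = onLeg⇒palm br o′
    onward px py xb eq | inj₁ refl with palm⇒ py
    ... | inj₁ refl = contradiction eq side-≢
    ... | inj₂ (w , leg , s) with refl ← side-unique xb (proj₁ leg) eq s = onLeg⇒palm br (w , leg , side-self xb)
    go : ∀ k {x y} → d x y ≡ k → Palm G v x → Palm G v y → Trail G (Palm G v) x y k
    go k {x} {y} eq px py with x ≟ y
    go zero eq px py | yes refl = here px
    go (suc k) {x} eq px py | yes refl = contradiction (trans (sym eq) (d-refl x)) λ ()
    go zero eq px py | no x≢y = contradiction (d≡0 eq) x≢y
    go (suc k) {x} {y} eq px py | no x≢y with b , xb , e ← next x≢y =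
      px ∷⟨ xb ⟩ go k (suc-injective (trans (sym e) eq)) (onward px py xb e) py

-- Colouring a palm with one colour per leg

odd : ℕ → Bool
odd zero = false
odd (suc k) = not (odd k)

module _ {n} (xs : List (Fin n)) where

  open DecMembership (_≟_ {n}) using (_∈?_)

  -- Zero stands for absence from `xs`, so it is free to colour the even depths.
  position : Fin n → Fin (suc (length xs))
  position x with x ∈? xs
  ... | yes x∈ = suc (index {xs = xs} x∈)
  ... | no _ = zero

  position-≢zero : ∀ {x} → x ∈ xs → position x ≢ zero
  position-≢zero {x} x∈ eq with x ∈? xs
  ... | no x∉ = x∉ x∈
  position-≢zero x∈ () | yes _

  position-injective : ∀ {x y} → x ∈ xs → position x ≡ position y → x ≡ y
  position-injective {x} {y} x∈ eq with x ∈? xs | y ∈? xs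
  ... | no x∉ | _ = contradiction x∈ x∉
  position-injective x∈ () | yes _ | no _
  position-injective {x} {y} x∈ eq | yes p | yes q = index-injective (setoid (Fin n)) {x} {y} {xs} p q (Fin-suc-injective eq)

module Spider {n} (G : Graph n) (tree : IsTree G) where

  open Metric G tree
  open Legs G tree
  open Codes G tree

  legs : Fin n → List (Fin n)
  legs v = filter (leg? v) (allFin n)

  ∈-legs : ∀ {v w} → Leg v w → w ∈ legs v
  ∈-legs {v} = ∈-filter⁺ (leg? v) (∈-allFin _)

  -- The neighbour of `v` towards `u`, with `v` as default when `u` is `v`.
  direction : Fin n → Fin n → Fin n
  direction v u with v ≟ u
  ... | yes _ = v
  ... | no v≢u = proj₁ (next v≢u)

  direction-side : ∀ {v w u} → v ~ w → Side v w u → direction v u ≡ w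
  direction-side {v} {w} {u} vw s with v ≟ u
  ... | yes refl = contradiction s side-≢
  ... | no v≢u with x , vx , sx ← next v≢u = side-unique vx vw sx s

  module _ {v} (eb : EndBranch G v) where

    private
      br : Branch G v
      br = proj₁ eb

    colour : Fin n → Fin (suc (length (legs v)))
    colour u = if odd (d v u) then position (legs v) (direction v u) else zero

    colour-odd : ∀ {w u} → Leg v w → Side v w u → odd (d v u) ≡ true → colour u ≡ position (legs v) w
    colour-odd leg s o rewrite o = cong (position (legs v)) (direction-side (proj₁ leg) s)

    colour-even : ∀ {u} → odd (d v u) ≡ false → colour u ≡ zero
    colour-even o rewrite o = refl

    odd-onLeg : ∀ {u} → Palm G v u → odd (d v u) ≡ true → OnLeg v u
    odd-onLeg pu o with palm⇒ pu
    ... | inj₂ l = l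
    ... | inj₁ refl = contradiction (trans (sym (cong odd (d-refl v))) o) λ ()

    colour-odd-≢zero : ∀ {u} → Palm G v u → odd (d v u) ≡ true → colour u ≢ zero
    colour-odd-≢zero pu o eq with w , leg , s ← odd-onLeg pu o =
      position-≢zero (legs v) (∈-legs leg) (trans (sym (colour-odd leg s o)) eq)

    colour⁻ : ∀ {w t} → Leg v w → Palm G v t → colour t ≡ position (legs v) w → Side v w t
    colour⁻ {w} {t} leg pt eq = go (odd (d v t)) refl
      where
      go : ∀ b → odd (d v t) ≡ b → Side v w t
      go false o = contradiction (trans (sym eq) (colour-even o)) (position-≢zero (legs v) (∈-legs leg))
      go true o with w′ , leg′ , s ← odd-onLeg pt o =
        subst (λ x → Side v x t)
          (sym (position-injective (legs v) (∈-legs leg) (trans (sym eq) (colour-odd leg′ s o)))) s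

    colour-differs : ∀ {u t} → Palm G v u → Palm G v t → d v u ≡ suc (d v t) → colour u ≢ colour t
    colour-differs {u} {t} pu pt e eq = go (odd (d v t)) refl
      where
      go : ∀ b → odd (d v t) ≡ b → ⊥
      go false o = colour-odd-≢zero pu (trans (cong odd e) (cong not o)) (trans eq (colour-even o))
      go true o = colour-odd-≢zero pt o (trans (sym eq) (colour-even (trans (cong odd e) (cong not o))))

    colour-proper : Proper G (Palm G v) colour
    colour-proper u t pu pt ut with adj-dist ut v
    ... | inj₁ e = colour-differs pu pt (trans (d-sym v u) (trans e (cong suc (d-sym t v))))
    ... | inj₂ e = ≢-sym (colour-differs pt pu (trans (d-sym v t) (trans e (cong suc (d-sym u v)))))

    another-leg : ∀ w → ∃ λ w′ → Leg v w′ × w′ ≢ w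
    another-leg w with a , b , a≢b , la , lb ← end-branch-legs eb with a ≟ w
    ... | yes refl = b , lb , ≢-sym a≢b
    ... | no a≢w = a , la , a≢w

    leg∈palm : ∀ {w u} → Leg v w → Side v w u → Palm G v u
    leg∈palm leg s = onLeg⇒palm br (_ , leg , s)

    -- At odd depth take `u` itself, at even depth its parent; the parent is still on the leg
    -- because `w` has depth one.
    same-colour-near : ∀ {w u} → Leg v w → Side v w u →
      ∃ λ t → Palm G v t × colour t ≡ position (legs v) w × d u t ≤ 1
    same-colour-near {w} {u} leg s = go (odd (d v u)) refl
      where
      go : ∀ b → odd (d v u) ≡ b → ∃ λ t → Palm G v t × colour t ≡ position (legs v) w × d u t ≤ 1
      go true o = u , leg∈palm leg s , colour-odd leg s o , ≤-trans (≤-reflexive (d-refl u)) z≤n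
      go false o with next {u} {v} (λ { refl → side-≢ s })
      ... | q , uq , e = q , leg∈palm leg sq , colour-odd leg sq oq , d≤1 uq
        where
        dvu : d v u ≡ suc (d v q)
        dvu = trans (d-sym v u) (trans e (cong suc (d-sym q v)))
        oq : odd (d v q) ≡ true
        oq with odd (d v q) | trans (sym (cong odd dvu)) o
        ... | true | _ = refl
        sq : Side v w q
        sq = nearer-inside (proj₁ leg) s uq
          λ { refl → contradiction (trans (sym o) (cong odd (trans s (cong suc (d-refl u))))) λ () }

    first-colour : ∀ {w} → Leg v w → colour w ≡ position (legs v) w
    first-colour {w} leg = colour-odd leg (side-self (proj₁ leg))
      (cong odd (trans (side-self (proj₁ leg)) (cong suc (d-refl w))))

    -- The colour of a leg occurs only on that leg, and the way there from outside passes through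
    -- `v`.
    off-leg : ∀ {w u t} → Leg v w → ¬ Side v w u → Palm G v t → colour t ≡ position (legs v) w →
      suc (d u v) ≤ d u t
    off-leg {w} {u} {t} leg ¬s pt ct = subst (suc (d u v) ≤_) (sym path) (+-monoˡ-≤ (d u v) (0<d t≢v))
      where
      st : Side v w t
      st = colour⁻ leg pt ct
      t≢v : t ≢ v
      t≢v refl = side-≢ st
      path : d u t ≡ d t v + d u v
      path = trans (d-sym u t) (trans (separation (proj₁ leg) st ¬s) (cong (d t v +_) (d-sym v u)))

    -- Compare distances to the colour of another leg `w₂`: at most `d u v + 1` from `u`, and at
    -- least `d u′ v + 1` from `u′` by `off-leg`.
    deeper-on-leg : ∀ {w u u′} → Leg v w → Side v w u′ → Dominates (Palm G v) colour u u′ → d u′ v ≤ d u v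
    deeper-on-leg {w} {u} {u′} leg s′ dom with w₂ , leg₂ , w₂≢w ← another-leg w
      with t , pt , ct , le ← dom w₂ (leg∈palm leg₂ (side-self (proj₁ leg₂))) =
      ≤-pred (≤-trans (off-leg leg₂ (λ s → w₂≢w (side-unique (proj₁ leg₂) (proj₁ leg) s s′)) pt (trans ct (first-colour leg₂)))
        (≤-trans le (d-step′ u (~-sym (proj₁ leg₂)))))

    -- The colour of the leg is within distance one of `u`, hence of `u′`, and `off-leg` forces
    -- `u′ ≡ v`. Then `deeper-on-leg` puts `u` at depth zero too.
    not-off-leg : ∀ {w u u′} → Leg v w → Side v w u → ¬ Side v w u′ →
      Dominates (Palm G v) colour u u′ → ¬ Dominates (Palm G v) colour u′ u
    not-off-leg {w} {u} {u′} leg s ¬s′ dom dom′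
      with t , pt , ct , near ← same-colour-near leg s
      with t′ , pt′ , ct′ , le ← dom t pt
      with refl ← d≡0 (n≤0⇒n≡0 (≤-pred (≤-trans (off-leg leg ¬s′ pt′ (trans ct′ ct)) (≤-trans le near)))) =
      side-≢ (subst (Side v w) (d≡0 (n≤0⇒n≡0 (≤-trans (deeper-on-leg leg s dom′) (≤-reflexive (d-refl v))))) s)

    colour-separates : Separates (Palm G v) colour
    colour-separates {u} {u′} pu pu′ dom dom′ with palm⇒ pu | palm⇒ pu′
    ... | inj₁ refl | inj₁ refl = refl
    ... | inj₁ refl | inj₂ (w , leg , s) = contradiction dom (not-off-leg leg s side-≢ dom′)
    ... | inj₂ (w , leg , s) | _ with side? v w u′
    ...   | no ¬s′ = contradiction dom′ (not-off-leg leg s ¬s′ dom)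
    ...   | yes s′ = leg-depth-injective leg s s′ (subst₂ _≡_ (d-sym u v) (d-sym u′ v)
              (≤-antisym (deeper-on-leg leg s dom′) (deeper-on-leg leg s′ dom)))

    palm-colouring : HasLocatingColoring G (Palm G v) (suc (length (legs v)))
    palm-colouring = colour , colour-proper , separates⇒locating (palm-closed br) (palm? br) colour-separates

  -- `direction` maps the leaves on legs of `v` onto the first vertices of these legs, so no
  -- injective choice of leaves is required.
  legs≤leaves : ∀ {ls v} → Enumerates ls (Leaf G) → Branch G v →
    length (legs v) ≤ length (filter (onLeg? v) ls)
  legs≤leaves {ls} {v} (_ , enum) br =
    subst (length (legs v) ≤_) (length-map (direction v) (filter (onLeg? v) ls))
      (length-⊆ (filter⁺ (leg? v) (allFin⁺ n)) cover)
    where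
    cover : ∀ {w} → w ∈ legs v → w ∈ map (direction v) (filter (onLeg? v) ls)
    cover {w} w∈ with leg ← proj₂ (∈-filter⁻ (leg? v) {xs = allFin n} w∈)
      with ℓ , lf , s , _ ← leg-end-path br leg =
      subst (_∈ map (direction v) (filter (onLeg? v) ls)) (direction-side (proj₁ leg) s)
        (∈-map⁺ (direction v) (∈-filter⁺ (onLeg? v) (proj₂ (enum ℓ) lf) (w , leg , s)))

-- Summation over the fibres

module _ {A : Set} where

  sum-+ : (f g : A → ℕ) (xs : List A) → sum (map (λ x → f x + g x) xs) ≡ sum (map f xs) + sum (map g xs)
  sum-+ f g [] = refl
  sum-+ f g (x ∷ xs) rewrite sum-+ f g xs = swap (f x) (g x) (sum (map f xs)) (sum (map g xs))
    where
    swap : ∀ a b c e → a + b + (c + e) ≡ a + c + (b + e)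
    swap = solve-∀

  sum-mono : {f g : A → ℕ} (xs : List A) → (∀ {x} → x ∈ xs → f x ≤ g x) → sum (map f xs) ≤ sum (map g xs)
  sum-mono [] le = z≤n
  sum-mono (x ∷ xs) le = +-mono-≤ (le (here refl)) (sum-mono xs (λ x∈ → le (there x∈)))

  sum-shift-≤ : {f g : A → ℕ} (c : ℕ) (xs : List A) → (∀ {x} → x ∈ xs → f x ≤ g x + c) →
    sum (map f xs) ≤ sum (map g xs) + length xs * c
  sum-shift-≤ {f} {g} c xs le = ≤-trans (sum-mono xs le)
    (≤-reflexive (trans (sum-+ g (λ _ → c) xs) (cong (sum (map g xs) +_) (sum-const c xs))))

  sum-shift-≥ : {f g : A → ℕ} (c : ℕ) (xs : List A) → (∀ {x} → x ∈ xs → g x + c ≤ f x) →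
    sum (map g xs) + length xs * c ≤ sum (map f xs)
  sum-shift-≥ {f} {g} c xs le = ≤-trans
    (≤-reflexive (sym (trans (sum-+ g (λ _ → c) xs) (cong (sum (map g xs) +_) (sum-const c xs)))))
    (sum-mono xs le)

module _ {A B : Set} {R : A → B → Set} (R? : ∀ a b → Dec (R a b)) where

  private
    indicator : B → A → ℕ
    indicator b a = if does (R? a b) then 1 else 0

    count-∷ : ∀ b bs a → length (filter (R? a) (b ∷ bs)) ≡ indicator b a + length (filter (R? a) bs)
    count-∷ b bs a with does (R? a b)
    ... | true = refl
    ... | false = refl

    none : ∀ b as → (∀ {a} → a ∈ as → ¬ R a b) → sum (map (indicator b) as) ≡ 0
    none b [] _ = refl
    none b (a ∷ as) no-a with R? a b
    ... | yes r = contradiction r (no-a (here refl))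
    ... | no _ = none b as (λ a∈ → no-a (there a∈))

    at-most-one : ∀ b {as} → Unique as → (∀ {a a′} → a ∈ as → a′ ∈ as → R a b → R a′ b → a ≡ a′) →
      sum (map (indicator b) as) ≤ 1
    at-most-one b [] _ = z≤n
    at-most-one b {a ∷ as} (a≢ ∷ uq) fun with R? a b
    ... | yes r = ≤-reflexive (cong suc (none b as λ a′∈ r′ → All.lookup a≢ a′∈ (fun (here refl) (there a′∈) r r′)))
    ... | no _ = at-most-one b uq (λ p q → fun (there p) (there q))

  -- Double counting: each `b` is related to at most one `a`, so it contributes at most one to the
  -- sum.
  sum-fibres : ∀ {as} bs → Unique as → (∀ {a a′ b} → a ∈ as → a′ ∈ as → R a b → R a′ b → a ≡ a′) →
    sum (map (λ a → length (filter (R? a) bs)) as) ≤ length bs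
  sum-fibres {as} [] uq fun = ≤-reflexive (trans (sum-const 0 as) (*-zeroʳ (length as)))
  sum-fibres {as} (b ∷ bs) uq fun = begin
    sum (map (λ a → length (filter (R? a) (b ∷ bs))) as)
      ≤⟨ sum-mono as (λ {a} _ → ≤-reflexive (count-∷ b bs a)) ⟩
    sum (map (λ a → indicator b a + length (filter (R? a) bs)) as)
      ≡⟨ sum-+ (indicator b) (λ a → length (filter (R? a) bs)) as ⟩
    sum (map (indicator b) as) + sum (map (λ a → length (filter (R? a) bs)) as)
      ≤⟨ +-mono-≤ (at-most-one b uq fun) (sum-fibres bs uq fun) ⟩
    suc (length bs) ∎
    where open ≤-Reasoning

-- Disjoint blocks of colours

module _ {A : Set} (f : A → ℕ) where

  -- A block is addressed by the membership proof, that is, by the position of `x` in the list.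
  block : ∀ {xs x} → x ∈ xs → Fin (f x) → Fin (sum (map f xs))
  block {x ∷ xs} (here refl) i = i ↑ˡ sum (map f xs)
  block {x ∷ xs} (there x∈) i = f x ↑ʳ block x∈ i

  ↑ˡ≢↑ʳ : ∀ {m k} (i : Fin m) (j : Fin k) → i ↑ˡ k ≢ m ↑ʳ j
  ↑ˡ≢↑ʳ {m} {k} i j eq
    with () ← trans (sym (splitAt-↑ˡ m i k)) (trans (cong (splitAt m) eq) (splitAt-↑ʳ m k j))

  block-owner : ∀ {xs x y} (x∈ : x ∈ xs) (y∈ : y ∈ xs) {i j} → block x∈ i ≡ block y∈ j → x ≡ y
  block-owner (here refl) (here refl) _ = refl
  block-owner (here refl) (there y∈) {i} eq = contradiction eq (↑ˡ≢↑ʳ i _)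
  block-owner (there x∈) (here refl) {j = j} eq = contradiction (sym eq) (↑ˡ≢↑ʳ j _)
  block-owner {x ∷ _} (there x∈) (there y∈) eq = block-owner x∈ y∈ (↑ʳ-injective (f x) _ _ eq)

  block-injective : ∀ {xs x} (x∈ : x ∈ xs) {i j} → block x∈ i ≡ block x∈ j → i ≡ j
  block-injective (here refl) eq = ↑ˡ-injective _ _ _ eq
  block-injective {x ∷ _} (there x∈) eq = block-injective x∈ (↑ʳ-injective (f x) _ _ eq)

-- Renumbers the colours other than `α` and `β`: first `α` is punched out, then the image of `β`.
omit : ∀ {m} {α β : Fin m} → α ≢ β → ∀ {i} → α ≢ i → β ≢ i → Fin (m ∸ 2)
omit {suc zero} {zero} {zero} α≢β _ _ = contradiction refl α≢β
omit {suc (suc m)} α≢β α≢i β≢i =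
  punchOut {i = punchOut α≢β} {j = punchOut α≢i} λ eq → β≢i (punchOut-injective α≢β α≢i eq)

omit-injective : ∀ {m} {α β : Fin m} (α≢β : α ≢ β) {i j} (α≢i : α ≢ i) (β≢i : β ≢ i) (α≢j : α ≢ j) (β≢j : β ≢ j) →
  omit α≢β α≢i β≢i ≡ omit α≢β α≢j β≢j → i ≡ j
omit-injective {suc zero} {zero} {zero} α≢β _ _ _ _ _ = contradiction refl α≢β
omit-injective {suc (suc m)} α≢β α≢i β≢i α≢j β≢j eq =
  punchOut-injective α≢i α≢j
    (punchOut-injective (λ e → β≢i (punchOut-injective α≢β α≢i e)) (λ e → β≢j (punchOut-injective α≢β α≢j e)) eq)

≢⇒2≤ : ∀ {m} {α β : Fin m} → α ≢ β → 2 ≤ m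
≢⇒2≤ {suc zero} {zero} {zero} α≢β = contradiction refl α≢β
≢⇒2≤ {suc (suc m)} _ = s≤s (s≤s z≤n)

opposite-≢ : (i : Fin 2) → i ≢ opposite i
opposite-≢ zero ()
opposite-≢ (suc zero) ()

-- Third colours in a palm

module PalmColours {n} (G : Graph n) (tree : IsTree G) {v} (eb : EndBranch G v)
                   {m} (c : Fin n → Fin m)
                   (proper : Proper G (Palm G v) c) (locating : Locating G (Palm G v) c) where

  open Metric G tree
  open Legs G tree
  open Codes G tree

  br : Branch G v
  br = proj₁ eb

  first second : Fin n
  first = proj₁ (end-branch-legs eb)
  second = proj₁ (proj₂ (end-branch-legs eb))

  first≢second : first ≢ second
  first≢second = proj₁ (proj₂ (proj₂ (end-branch-legs eb)))

  first-leg : Leg v first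
  first-leg = proj₁ (proj₂ (proj₂ (proj₂ (end-branch-legs eb))))

  second-leg : Leg v second
  second-leg = proj₂ (proj₂ (proj₂ (proj₂ (end-branch-legs eb))))

  leg-start∈palm : ∀ {w} → Leg v w → Palm G v w
  leg-start∈palm leg = onLeg⇒palm br (_ , leg , side-self (proj₁ leg))

  centre∈palm : Palm G v v
  centre∈palm = inj₁ refl

  α β : Fin m
  α = c v
  β = c first

  leg-start-colour : ∀ {w} → Leg v w → α ≢ c w
  leg-start-colour leg = proper v _ centre∈palm (leg-start∈palm leg) (proj₁ leg)

  α≢β : α ≢ β
  α≢β = leg-start-colour first-leg

  separates : Separates (Palm G v) c
  separates = locating⇒separates (palm-closed br) locating

  Third : Fin n → Set
  Third t = Palm G v t × α ≢ c t × β ≢ c t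

  third? : Decidable Third
  third? t = palm? br t ×-dec (¬? (α ≟ c t) ×-dec ¬? (β ≟ c t))

  -- With two colours the leg starts all get the code (1 , 0).
  third-exists : ∃ Third
  third-exists with any? third?
  ... | yes t = t
  ... | no none = contradiction
    (separates (leg-start∈palm first-leg) (leg-start∈palm second-leg)
      (dominates first-leg second-leg refl second-β) (dominates second-leg first-leg second-β refl))
    first≢second
    where
    two-coloured : ∀ {t} → Palm G v t → α ≢ c t → β ≡ c t
    two-coloured {t} pt α≢ = decidable-stable (β ≟ c t) λ β≢ → none (t , pt , α≢ , β≢)
    second-β : β ≡ c second
    second-β = two-coloured (leg-start∈palm second-leg) (leg-start-colour second-leg)
    dominates : ∀ {x y} → Leg v x → Leg v y → β ≡ c x → β ≡ c y → Dominates (Palm G v) c x y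
    dominates {x} {y} lx ly βx βy t pt with α ≟ c t
    ... | yes e = v , centre∈palm , e ,
      ≤-trans (d≤1 (~-sym (proj₁ ly))) (0<d λ { refl → α≢β (trans e (sym βx)) })
    ... | no ne = y , leg-start∈palm ly , trans (sym βy) (two-coloured pt ne) , ≤-trans (≤-reflexive (d-refl y)) z≤n

  nearest-third : ∃ λ t → Third t × (∀ y → Third y → d v t ≤ d v y)
  nearest-third = argmin third? (d v) third-exists

  -- The only way out of the palm is through `v`, followed by at least one more edge.
  palm-exit : ∀ {y t} → Palm G v y → ¬ Palm G v t → suc (d y v) ≤ d y t
  palm-exit {y} {t} py ¬pt with palm⇒ py
  ... | inj₁ refl = subst (λ x → suc x ≤ d y t) (sym (d-refl y)) (0<d λ { refl → ¬pt centre∈palm })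
  ... | inj₂ o = subst (suc (d y v) ≤_) (sym (onLeg-separation o (λ o′ → ¬pt (onLeg⇒palm br o′))))
    (subst (_≤ d y v + d v t) (+-comm (d y v) 1) (+-monoʳ-≤ (d y v) (0<d λ { refl → ¬pt centre∈palm })))

-- Colouring the tree from its palms

module Combine {n} (G : Graph n) (tree : IsTree G) (root : Fin n) (root-branch : Branch G root)
               (bs : List (Fin n)) (enum : Enumerates bs (EndBranch G)) (χ : Fin n → ℕ)
               (palm-col : ∀ v → v ∈ bs → HasLocatingColoring G (Palm G v) (χ v)) where

  open Metric G tree
  open Legs G tree
  open Codes G tree
  open DecMembership (_≟_ {n}) using (_∈?_)

  M : ℕ
  M = sum (map (λ v → χ v ∸ 2) bs)

  end-branch : ∀ {v} → v ∈ bs → EndBranch G v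
  end-branch v∈ = proj₁ (proj₂ enum _) v∈

  is-branch : ∀ {v} → v ∈ bs → Branch G v
  is-branch v∈ = proj₁ (end-branch v∈)

  module P {v} (v∈ : v ∈ bs) where
    c : Fin n → Fin (χ v)
    c = proj₁ (palm-col v v∈)
    proper : Proper G (Palm G v) c
    proper = proj₁ (proj₂ (palm-col v v∈))
    open PalmColours G tree (end-branch v∈) c proper (proj₂ (proj₂ (palm-col v v∈))) public

  tone : ℕ → Fin 2
  tone zero = zero
  tone (suc k) = opposite (tone k)

  Hue : Set
  Hue = Fin 2 ⊎ Fin M

  -- The centre's colour becomes the parity colour of `v` itself, so that the palm agrees with the
  -- 2-colouring outside the legs.
  classify : ∀ {v} (v∈ : v ∈ bs) → Fin (χ v) → Hue
  classify {v} v∈ i with P.α v∈ ≟ i | P.β v∈ ≟ i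
  ... | yes _ | _ = inj₁ (tone (d root v))
  ... | no _ | yes _ = inj₁ (opposite (tone (d root v)))
  ... | no α≢i | no β≢i = inj₂ (block (λ v → χ v ∸ 2) v∈ (omit (P.α≢β v∈) α≢i β≢i))

  classify-injective : ∀ {v} (v∈ : v ∈ bs) {i j} → classify v∈ i ≡ classify v∈ j → i ≡ j
  classify-injective {v} v∈ {i} {j} eq with P.α v∈ ≟ i | P.β v∈ ≟ i | P.α v∈ ≟ j | P.β v∈ ≟ j
  ... | yes e | _ | yes e′ | _ = trans (sym e) e′
  ... | yes e | _ | no _ | yes e′ = contradiction (inj₁-injective eq) (opposite-≢ _)
  classify-injective v∈ () | yes e | _ | no _ | no _
  ... | no _ | yes e | yes e′ | _ = contradiction (sym (inj₁-injective eq)) (opposite-≢ _)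
  ... | no _ | yes e | no _ | yes e′ = trans (sym e) e′
  classify-injective v∈ () | no _ | yes e | no _ | no _
  classify-injective v∈ () | no _ | no _ | yes _ | _
  classify-injective v∈ () | no _ | no _ | no _ | yes _
  ... | no α≢i | no β≢i | no α≢j | no β≢j =
    omit-injective (P.α≢β v∈) α≢i β≢i α≢j β≢j (block-injective _ v∈ (inj₂-injective eq))

  classify-centre : ∀ {v} (v∈ : v ∈ bs) → classify v∈ (P.c v∈ v) ≡ inj₁ (tone (d root v))
  classify-centre v∈ with P.α v∈ ≟ P.α v∈
  ... | yes _ = refl
  ... | no ne = contradiction refl ne

  Private : Fin n → Hue → Set
  Private v h = Σ (v ∈ bs) λ v∈ → ∃ λ i → h ≡ inj₂ (block (λ v → χ v ∸ 2) v∈ i)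

  classify-third : ∀ {v} (v∈ : v ∈ bs) {i} → P.α v∈ ≢ i → P.β v∈ ≢ i → Private v (classify v∈ i)
  classify-third v∈ {i} α≢i β≢i with P.α v∈ ≟ i | P.β v∈ ≟ i
  ... | yes e | _ = contradiction e α≢i
  ... | no _ | yes e = contradiction e β≢i
  ... | no _ | no _ = v∈ , _ , refl

  classify-private : ∀ {v v′} (v∈ : v ∈ bs) {i} → Private v′ (classify v∈ i) → v ≡ v′
  classify-private v∈ {i} (v′∈ , j , eq) with P.α v∈ ≟ i | P.β v∈ ≟ i
  classify-private v∈ (v′∈ , j , ()) | yes _ | _
  classify-private v∈ (v′∈ , j , ()) | no _ | yes _
  ... | no _ | no _ = block-owner _ v∈ v′∈ (inj₂-injective eq)

  Owned : Fin n → Set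
  Owned u = ∃ λ v → v ∈ bs × OnLeg v u

  owned? : Decidable Owned
  owned? u = any? λ v → (v ∈? bs) ×-dec onLeg? v u

  hue : Fin n → Hue
  hue u with owned? u
  ... | yes (v , v∈ , _) = classify v∈ (P.c v∈ u)
  ... | no _ = inj₁ (tone (d root u))

  hue-free : ∀ {u} → ¬ Owned u → hue u ≡ inj₁ (tone (d root u))
  hue-free {u} ¬o with owned? u
  ... | yes o = contradiction o ¬o
  ... | no _ = refl

  -- On a leg the owner found by `owned?` must be `v`. The centre is a branch, hence not owned, and
  -- its parity hue agrees by `classify-centre`.
  hue-palm : ∀ {v u} (v∈ : v ∈ bs) → Palm G v u → hue u ≡ classify v∈ (P.c v∈ u)
  hue-palm {v} {u} v∈ pu with owned? u | palm⇒ pu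
  ... | yes (v′ , v′∈ , o) | inj₁ refl = contradiction (is-branch v∈) (onLeg-not-branch o)
  ... | yes (v′ , v′∈ , o) | inj₂ o′ with refl ← onLeg-owner (is-branch v′∈) (is-branch v∈) o o′
      -- `classify` depends on the membership proof, which is unique because `bs` has no
      -- repetitions.
      with refl ← unique⇒irrelevant (proj₁ enum) v∈ v′∈ = refl
  hue-palm v∈ pu | no ¬o | inj₁ refl = sym (classify-centre v∈)
  hue-palm v∈ pu | no ¬o | inj₂ o = contradiction (_ , v∈ , o) ¬o

  hue-private : ∀ {v t} → Private v (hue t) → OnLeg v t
  hue-private {v} {t} pr with owned? t
  ... | yes (v′ , v′∈ , o) = subst (λ x → OnLeg x t) (classify-private v′∈ pr) o
  hue-private (_ , _ , ()) | no _

  owned-proper : ∀ {v u t} → v ∈ bs → OnLeg v u → u ~ t → hue u ≢ hue t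
  owned-proper {v} {u} {t} v∈ o ut eq = P.proper v∈ u t pu pt ut
    (classify-injective v∈ (trans (sym (hue-palm v∈ pu)) (trans eq (hue-palm v∈ pt))))
    where
    pu : Palm G v u
    pu = onLeg⇒palm (is-branch v∈) o
    pt : Palm G v t
    pt = [ inj₁ , onLeg⇒palm (is-branch v∈) ]′ (onLeg-nbr o ut)

  free-proper : ∀ {u t} → ¬ Owned u → ¬ Owned t → u ~ t → hue u ≢ hue t
  free-proper {u} {t} ¬ou ¬ot ut eq = go (adj-dist ut root)
    where
    tones : tone (d root u) ≡ tone (d root t)
    tones = inj₁-injective (trans (sym (hue-free ¬ou)) (trans eq (hue-free ¬ot)))
    from-root : ∀ {x y} → d x root ≡ suc (d y root) → d root x ≡ suc (d root y)
    from-root {x} {y} e = trans (d-sym root x) (trans e (cong suc (d-sym y root)))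
    go : ¬ (d u root ≡ suc (d t root) ⊎ d t root ≡ suc (d u root))
    go (inj₁ e) = opposite-≢ _ (trans (sym tones) (cong tone (from-root e)))
    go (inj₂ e) = opposite-≢ _ (trans tones (cong tone (from-root e)))

  hue-proper : ∀ {u t} → u ~ t → hue u ≢ hue t
  hue-proper {u} {t} ut = go (owned? u) (owned? t)
    where
    go : Dec (Owned u) → Dec (Owned t) → hue u ≢ hue t
    go (yes (v , v∈ , o)) _ = owned-proper v∈ o ut
    go (no _) (yes (v , v∈ , o)) = ≢-sym (owned-proper v∈ o (~-sym ut))
    go (no ¬ou) (no ¬ot) = free-proper ¬ou ¬ot ut

  -- Comparing codes across palms

  Dom : Fin n → Fin n → Set
  Dom x y = ∀ t → ∃ λ t′ → hue t′ ≡ hue t × d y t′ ≤ d x t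

  -- A witness `t′` outside the palm cannot carry a private hue of `v`, so `t` has colour `α` or
  -- `β`. Then `v` or `first` replaces `t′`, and by `palm-exit` neither is farther from `y`.
  restrict : ∀ {v x y} (v∈ : v ∈ bs) → Palm G v y → Dom x y → Dominates (Palm G v) (P.c v∈) x y
  restrict {v} {x} {y} v∈ py dom t pt with t′ , same , le ← dom t = go (palm? br t′) (α ≟ c t) (β ≟ c t)
    where
    open P v∈
    go : Dec (Palm G v t′) → Dec (α ≡ c t) → Dec (β ≡ c t) → ∃ λ t″ → Palm G v t″ × c t″ ≡ c t × d y t″ ≤ d x t
    go (yes pt′) _ _ =
      t′ , pt′ , classify-injective v∈ (trans (sym (hue-palm v∈ pt′)) (trans same (hue-palm v∈ pt))) , le
    go (no ¬pt′) (yes e) _ = v , centre∈palm , e , ≤-trans (n≤1+n _) (≤-trans (palm-exit py ¬pt′) le)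
    go (no ¬pt′) (no _) (yes e) = first , leg-start∈palm first-leg , e ,
      ≤-trans (d-step′ y (~-sym (proj₁ first-leg))) (≤-trans (palm-exit py ¬pt′) le)
    go (no ¬pt′) (no α≢) (no β≢) = contradiction
      (onLeg⇒palm br (hue-private (subst (Private v) (trans (sym (hue-palm v∈ pt)) (sym same)) (classify-third v∈ α≢ β≢))))
      ¬pt′

  -- From outside the legs of v, its third colours are reached through v.
  closer : ∀ {v x y} → v ∈ bs → ¬ OnLeg v y → Dom x y → d y v ≤ d x v
  closer {v} {x} {y} v∈ ¬oy dom
    -- Choosing `t` nearest to `v` guarantees that the witness `t′`, again a third-coloured vertex
    -- of this palm, satisfies `d v t ≤ d v t′`.
    with t , (pt , α≢ , β≢) , nearest ← P.nearest-third v∈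
    with t′ , same , le ← dom t = +-cancelʳ-≤ (d v t) _ _ bound
    where
    open P v∈ using (c; br)
    o′ : OnLeg v t′
    o′ = hue-private (subst (Private v) (trans (sym (hue-palm v∈ pt)) (sym same)) (classify-third v∈ α≢ β≢))
    pt′ : Palm G v t′
    pt′ = onLeg⇒palm br o′
    ct′ : c t ≡ c t′
    ct′ = classify-injective v∈ (trans (sym (hue-palm v∈ pt)) (trans (sym same) (hue-palm v∈ pt′)))
    bound : d y v + d v t ≤ d x v + d v t
    bound = begin
      d y v + d v t  ≤⟨ +-monoʳ-≤ (d y v) (nearest t′ (pt′ , subst (P.α v∈ ≢_) ct′ α≢ , subst (P.β v∈ ≢_) ct′ β≢)) ⟩
      d y v + d v t′ ≡⟨ +-comm (d y v) (d v t′) ⟩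
      d v t′ + d y v ≡⟨ cong₂ _+_ (d-sym v t′) (d-sym y v) ⟩
      d t′ v + d v y ≡⟨ sym (onLeg-separation o′ ¬oy) ⟩
      d t′ y         ≡⟨ d-sym t′ y ⟩
      d y t′         ≤⟨ le ⟩
      d x t          ≤⟨ d-tri x v t ⟩
      d x v + d v t  ∎
      where open ≤-Reasoning

  owner-unique : ∀ {v v′ u} → v ∈ bs → v′ ∈ bs → OnLeg v u → OnLeg v′ u → v ≡ v′
  owner-unique v∈ v′∈ = onLeg-owner (is-branch v∈) (is-branch v′∈)

  -- From `x`, `v′` lies behind `v`; from `y`, `v` lies behind `v′`. Applying `closer` to both
  -- centres leaves no room for `d v v′`.
  two-palms : ∀ {v v′ x y} → v ∈ bs → v′ ∈ bs → v ≢ v′ → OnLeg v x → OnLeg v′ y → Dom x y → ¬ Dom y x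
  two-palms {v} {v′} {x} {y} v∈ v′∈ v≢v′ ox oy dom dom′ = v≢v′ (d≡0 (m+n≤m⇒n≡0 {d x v} (begin
    d x v + d v v′  ≡⟨ sym (onLeg-separation ox (λ o → onLeg-not-branch o (is-branch v′∈))) ⟩
    d x v′          ≤⟨ closer v′∈ (λ o → v≢v′ (owner-unique v∈ v′∈ ox o)) dom′ ⟩
    d y v′          ≤⟨ m≤m+n _ _ ⟩
    d y v′ + d v′ v ≡⟨ sym (onLeg-separation oy (λ o → onLeg-not-branch o (is-branch v∈))) ⟩
    d y v           ≤⟨ closer v∈ (λ o → v≢v′ (owner-unique v∈ v′∈ o oy)) dom ⟩
    d x v           ∎)))
    where open ≤-Reasoning

  -- Let `w` be the step from `v` towards `y`. An end-branch `e` behind `w` would be strictly nearer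
  -- to `y` than to `x`: the path from `x` to `e` passes through `v`, while `y` bypasses `v` and is
  -- no farther from it. So the side of `w` is a leg and `y` is owned.
  palm-and-free : ∀ {v x y} → v ∈ bs → OnLeg v x → y ≢ v → ¬ Owned y → Dom x y → ¬ Dom y x
  palm-and-free {v} {x} {y} v∈ ox y≢v ¬oy dom dom′ with w , vw , sy ← next {v} {y} (≢-sym y≢v) =
    ¬oy (v , v∈ , w , end-branch-free⇒leg vw free , sy)
    where
    ¬oy′ : ¬ OnLeg v y
    ¬oy′ o = ¬oy (v , v∈ , o)
    ¬sx : ¬ Side v w x
    ¬sx s = ¬oy′ (w , subst (Leg v) (side-unique (proj₁ leg) vw (proj₂ (proj₂ ox)) s) leg , sy)
      where
      leg : Leg v (proj₁ ox)
      leg = proj₁ (proj₂ ox)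
    free : ∀ e → EndBranch G e → ¬ Side v w e
    free e eb se = <-irrefl refl (begin-strict
      d e v + d v x ≡⟨ sym (separation vw se ¬sx) ⟩
      d e x         ≡⟨ d-sym e x ⟩
      d x e         ≤⟨ closer e∈ (λ o → e≢v (owner-unique e∈ v∈ o ox)) dom′ ⟩
      d y e         ≤⟨ d-tri y w e ⟩
      d y w + d w e <⟨ +-mono-≤ (≤-reflexive (trans (cong suc (d-sym y w)) (sym sy))) (≤-trans (n≤1+n _) (≤-reflexive (sym se))) ⟩
      d v y + d v e ≡⟨ trans (+-comm (d v y) (d v e)) (cong₂ _+_ (d-sym v e) (d-sym v y)) ⟩
      d e v + d y v ≤⟨ +-monoʳ-≤ (d e v) (closer v∈ ¬oy′ dom) ⟩
      d e v + d x v ≡⟨ cong (d e v +_) (d-sym x v) ⟩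
      d e v + d v x ∎)
      where
      open ≤-Reasoning
      e∈ : e ∈ bs
      e∈ = proj₂ (proj₂ enum e) eb
      e≢v : e ≢ v
      e≢v refl = side-≢ se

  -- Vertices outside all legs

  -- `m` is where the paths from `x` and `y` to `e` meet. The field `between` is the invariant that
  -- lets both ends be extended away from `e`.
  record Midpoint (e x y : Fin n) : Set where
    field
      m x′ y′ : Fin n
      mx′ : m ~ x′
      my′ : m ~ y′
      x′≢y′ : x′ ≢ y′
      sx : Side m x′ x
      sy : Side m y′ y
      equidistant : d m x ≡ d m y
      between : d e x ≡ d e m + d m x

  -- Move both vertices one step towards `e`. If they meet, that is the midpoint; otherwise the
  -- midpoint of the parents serves for `x` and `y` as well.
  midpoint : ∀ {e} k {x y} → d x e ≡ k → d y e ≡ k → x ≢ y → Midpoint e x y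
  midpoint zero ex ey x≢y = contradiction (trans (d≡0 ex) (sym (d≡0 ey))) x≢y
  midpoint {e} (suc k) {x} {y} ex ey x≢y = go (px ≟ py)
    where
    ≢e : ∀ {z} → d z e ≡ suc k → z ≢ e
    ≢e ez refl = contradiction (trans (sym ez) (d-refl e)) λ ()
    px = proj₁ (next (≢e ex))
    py = proj₁ (next (≢e ey))
    xp : x ~ px
    xp = proj₁ (proj₂ (next (≢e ex)))
    yp : y ~ py
    yp = proj₁ (proj₂ (next (≢e ey)))
    epx : d px e ≡ k
    epx = suc-injective (trans (sym (proj₂ (proj₂ (next (≢e ex))))) ex)
    epy : d py e ≡ k
    epy = suc-injective (trans (sym (proj₂ (proj₂ (next (≢e ey))))) ey)
    level : ∀ {z p} → d z e ≡ suc k → d p e ≡ k → d e z ≡ suc (d e p)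
    level {z} {p} ez ep = trans (d-sym e z) (trans ez (cong suc (trans (sym ep) (d-sym p e))))
    one : ∀ {m z} → m ~ z → d m z ≡ 1
    one {m} {z} mz = trans (side-self mz) (cong suc (d-refl z))
    extend-d : ∀ {m z p} → d e p ≡ d e m + d m p → z ~ p → d e z ≡ suc (d e p) → d m z ≡ suc (d m p)
    extend-d {m} {z} {p} btw zp lev = ≤-antisym (d-step′ m zp)
      (+-cancelˡ-≤ (d e m) _ _ (≤-trans (≤-reflexive (trans (+-suc (d e m) (d m p)) (trans (cong suc (sym btw)) (sym lev))))
        (d-tri e m z)))
    extend-side : ∀ {m q z p} → m ~ q → Side m q p → z ~ p → d m z ≡ suc (d m p) → Side m q z
    extend-side {m} {q} {z} {p} mq sp zp far = decidable-stable (side? m q z) λ ¬s →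
      contradiction (trans (sym (d-refl m)) (trans (cong (d m) (sym (proj₂ (crossing mq (~-sym zp) sp ¬s)))) far)) λ ()
    go : Dec (px ≡ py) → Midpoint e x y
    go (yes p≡) = record
      { m = px ; x′ = x ; y′ = y ; mx′ = ~-sym xp ; my′ = my ; x′≢y′ = x≢y
      ; sx = side-self (~-sym xp) ; sy = side-self my
      ; equidistant = trans (one (~-sym xp)) (sym (one my))
      ; between = trans (level ex epx) (trans (+-comm 1 _) (cong (d e px +_) (sym (one (~-sym xp))))) }
      where
      my : px ~ y
      my = subst (_~ y) (sym p≡) (~-sym yp)
    go (no p≢) = record
      { m = m ; x′ = x′ ; y′ = y′ ; mx′ = mx′ ; my′ = my′ ; x′≢y′ = x′≢y′
      ; sx = extend-side mx′ sx xp dmx ; sy = extend-side my′ sy yp dmy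
      ; equidistant = trans dmx (trans (cong suc equidistant) (sym dmy))
      ; between = trans (level ex epx) (trans (cong suc between) (trans (sym (+-suc (d e m) (d m px))) (cong (d e m +_) (sym dmx)))) }
      where
      open Midpoint (midpoint k epx epy p≢)
      dmx : d m x ≡ suc (d m px)
      dmx = extend-d between xp (level ex epx)
      dmy : d m y ≡ suc (d m py)
      dmy = extend-d (trans (d-sym e py) (trans epy (trans (sym epx) (trans (d-sym px e) (trans between (cong (d e m +_) equidistant)))))) yp (level ey epy)

  -- If `e` were behind `x′`, then `x` would reach `e` by a shortcut avoiding `m`, while `y` must go
  -- through `m`, so `x` would be strictly nearer.
  half-free : ∀ {m x′ y′ x y e} → m ~ x′ → m ~ y′ → x′ ≢ y′ → Side m x′ x → Side m y′ y →
    d m x ≡ d m y → d x e ≡ d y e → ¬ Side m x′ e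
  half-free {m} {x′} {y′} {x} {y} {e} mx my x′≢y′ sx sy eqm eqe se = <-irrefl refl (begin-strict
    d x e           ≤⟨ d-tri x x′ e ⟩
    d x x′ + d x′ e <⟨ +-mono-≤ (≤-reflexive (trans (cong suc (d-sym x x′)) (sym sx))) (≤-trans (n≤1+n _) (≤-reflexive (sym se))) ⟩
    d m x + d m e   ≡⟨ cong (_+ d m e) (trans eqm (d-sym m y)) ⟩
    d y m + d m e   ≡⟨ sym (separation my sy (λ s → x′≢y′ (side-unique mx my se s))) ⟩
    d y e           ≡⟨ sym eqe ⟩
    d x e           ∎)
    where open ≤-Reasoning

  some-end-branch : ∃ (_∈ bs)
  some-end-branch with any? (_∈? bs)
  ... | yes r = r
  ... | no none = contradiction (λ e eb → none (e , proj₂ (proj₂ enum e) eb)) (end-branch-exists root-branch)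

  free-resolved : ∀ {x y} → ¬ Owned x → (∀ {e} → e ∈ bs → d x e ≡ d y e) → x ≡ y
  free-resolved {x} {y} ¬ox same = decidable-stable (x ≟ y) λ x≢y → absurd (midpoint _ refl (sym (same e∈)) x≢y)
    where
    e = proj₁ some-end-branch
    e∈ : e ∈ bs
    e∈ = proj₂ some-end-branch
    absurd : ¬ Midpoint e x y
    absurd mp with branch? G (Midpoint.m mp)
    -- Both sides are legs, so `m` is an end-branch and owns `x`.
    ... | yes br = ¬ox (m , proj₂ (proj₂ enum m) (two-legs⇒end-branch br legx legy x′≢y′) , x′ , legx , sx)
      where
      open Midpoint mp
      legx : Leg m x′
      legx = end-branch-free⇒leg mx′ λ e eb → half-free mx′ my′ x′≢y′ sx sy equidistant (same (proj₂ (proj₂ enum e) eb))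
      legy : Leg m y′
      legy = end-branch-free⇒leg my′ λ e eb → half-free my′ mx′ (≢-sym x′≢y′) sy sx (sym equidistant) (sym (same (proj₂ (proj₂ enum e) eb)))
    -- The step `z` towards `e` differs from `x′` and `y′` by `half-free`, and three neighbours
    -- would make `m` a branch.
    ... | no ¬br with z , mz , sz ← next {Midpoint.m mp} {e} (λ m≡e → ¬br (subst (Branch G) (sym m≡e) (is-branch e∈))) =
      ¬br (three-nbrs G mx′ my′ mz x′≢y′
        (λ { refl → half-free mx′ my′ x′≢y′ sx sy equidistant (same e∈) sz })
        (λ { refl → half-free my′ mx′ (≢-sym x′≢y′) sy sx (sym equidistant) (sym (same e∈)) sz }))
      where open Midpoint mp

  owned-separates : ∀ {v x y} (v∈ : v ∈ bs) → OnLeg v x → Dom x y → Dom y x → x ≡ y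
  owned-separates {v} {x} {y} v∈ ox dom dom′ = go (palm? br y)
    where
    open P v∈ using (br; separates)
    px : Palm G v x
    px = onLeg⇒palm br ox
    go : Dec (Palm G v y) → x ≡ y
    go (yes py) = separates px py (restrict v∈ py dom) (restrict v∈ px dom′)
    go (no ¬py) with owned? y
    ... | yes (v′ , v′∈ , oy) = contradiction dom′
      (two-palms v∈ v′∈ (λ { refl → ¬py (onLeg⇒palm br oy) }) ox oy dom)
    ... | no ¬oy = contradiction dom′ (palm-and-free v∈ ox (λ y≡v → ¬py (inj₁ y≡v)) ¬oy dom)

  hue-separates : ∀ {x y} → Dom x y → Dom y x → x ≡ y
  hue-separates {x} {y} dom dom′ = go (owned? x) (owned? y)
    where
    go : Dec (Owned x) → Dec (Owned y) → x ≡ y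
    go (yes (v , v∈ , ox)) _ = owned-separates v∈ ox dom dom′
    go (no _) (yes (v , v∈ , oy)) = sym (owned-separates v∈ oy dom′ dom)
    go (no ¬ox) (no ¬oy) = free-resolved ¬ox λ {e} e∈ →
      ≤-antisym (closer e∈ (λ o → ¬ox (e , e∈ , o)) dom′) (closer e∈ (λ o → ¬oy (e , e∈ , o)) dom)

  colour : Fin n → Fin (2 + M)
  colour u = join 2 M (hue u)

  colour⇒hue : ∀ {u t} → colour u ≡ colour t → hue u ≡ hue t
  colour⇒hue {u} {t} eq =
    trans (sym (splitAt-join 2 M (hue u))) (trans (cong (splitAt 2) eq) (splitAt-join 2 M (hue t)))

  tree-colouring : HasLocatingColoring G Full (2 + M)
  tree-colouring = colour , (λ u t _ _ ut eq → hue-proper ut (colour⇒hue eq)) ,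
    separates⇒locating full-closed (λ _ → yes tt) λ _ _ dom dom′ → hue-separates (hue-dom dom) (hue-dom dom′)
    where
    hue-dom : ∀ {x y} → Dominates Full colour x y → Dom x y
    hue-dom dom t with t′ , _ , eq , le ← dom t tt = t′ , colour⇒hue eq , le

  two-colours : ∀ {v} → v ∈ bs → 2 ≤ χ v
  two-colours v∈ = ≢⇒2≤ (P.α≢β v∈)

-- Assembling the inequalities

-- Subtracted terms are moved across each inequality, which avoids truncated subtraction; the last
-- inequality then reduces to comparing the numbers of branches.
theorem4 : ∀ {n} (G : Graph n) → IsTree G → (∃ λ v → Branch G v) →
    (ls βs bs : List (Fin n)) →
    Enumerates ls (Leaf G) → Enumerates βs (HasEndPath G) → Enumerates bs (EndBranch G) →
    (χT : ℕ) → LocChromNum G Full χT →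
    (χP : Fin n → ℕ) → (∀ v → v ∈ bs → LocChromNum G (Palm G v) (χP v)) →
    (χT + 2 * length bs ≤ 2 + sum (map χP bs))
    × (sum (map χP bs) + length βs ≤ length ls + 2 * length bs)
    × (length bs ≤ length βs)
theorem4 {n} G tree (root , root-branch) ls βs bs enum-ls enum-βs enum-bs χT (_ , χT-least) χP palm-χ =
  first-bound , second-bound , length-⊆ (proj₁ enum-bs) bs⊆βs
  where
  open Metric G tree
  open Legs G tree
  open Spider G tree
  open Combine G tree root root-branch bs enum-bs χP (λ v v∈ → proj₁ (palm-χ v v∈))
    using (M; tree-colouring; two-colours; end-branch; is-branch)

  leaves : Fin n → ℕ
  leaves v = length (filter (onLeg? v) ls)

  bs⊆βs : ∀ {v} → v ∈ bs → v ∈ βs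
  bs⊆βs v∈ with br , x , _ , _ , path , _ ← end-branch v∈ = proj₂ (proj₂ enum-βs _) (br , x , path)

  βs-branch : ∀ {v} → v ∈ βs → Branch G v
  βs-branch v∈ = proj₁ (proj₁ (proj₂ enum-βs _) v∈)

  βs-leaf : ∀ {v} → v ∈ βs → 1 ≤ leaves v
  βs-leaf {v} v∈ with _ , x , _ , _ , ep ← proj₁ (proj₂ enum-βs _) v∈ with w , leg , s , _ ← end-path-leg ep =
    length-⊆ ([] ∷ []) λ { (here refl) → ∈-filter⁺ (onLeg? v) (proj₂ (proj₂ enum-ls x) (proj₁ ep)) (w , leg , s) }

  -- Splitting off 2 per palm leaves the nonnegative summand `leaves v ∸ 1`, whose sum may be
  -- extended to all of `βs`.
  palm-bound : ∀ {v} → v ∈ bs → χP v ≤ (leaves v ∸ 1) + 2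
  palm-bound {v} v∈ = begin
    χP v                 ≤⟨ proj₂ (palm-χ v v∈) _ (palm-colouring (end-branch v∈)) ⟩
    suc (length (legs v)) ≤⟨ s≤s (legs≤leaves enum-ls (is-branch v∈)) ⟩
    suc (leaves v)       ≤⟨ s≤s (m≤n+m∸n (leaves v) 1) ⟩
    2 + (leaves v ∸ 1)   ≡⟨ +-comm 2 (leaves v ∸ 1) ⟩
    (leaves v ∸ 1) + 2   ∎
    where open ≤-Reasoning

  first-bound : χT + 2 * length bs ≤ 2 + sum (map χP bs)
  first-bound = begin
    χT + 2 * length bs      ≤⟨ +-monoˡ-≤ (2 * length bs) (χT-least _ tree-colouring) ⟩
    2 + M + 2 * length bs   ≡⟨ cong (2 + M +_) (*-comm 2 (length bs)) ⟩
    -- Each palm uses at least two colours, so the truncated `χP v ∸ 2` is exact.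
    2 + (M + length bs * 2) ≤⟨ s≤s (s≤s (sum-shift-≥ 2 bs (λ v∈ → ≤-reflexive (m∸n+n≡m (two-colours v∈))))) ⟩
    2 + sum (map χP bs)     ∎
    where open ≤-Reasoning

  second-bound : sum (map χP bs) + length βs ≤ length ls + 2 * length bs
  second-bound = begin
    sum (map χP bs) + length βs
      ≤⟨ +-monoˡ-≤ (length βs) (sum-shift-≤ 2 bs palm-bound) ⟩
    sum (map (λ v → leaves v ∸ 1) bs) + length bs * 2 + length βs
      ≤⟨ +-monoˡ-≤ (length βs) (+-monoˡ-≤ (length bs * 2) (sum-⊆ (λ v → leaves v ∸ 1) (proj₁ enum-bs) bs⊆βs)) ⟩
    sum (map (λ v → leaves v ∸ 1) βs) + length bs * 2 + length βs
      ≡⟨ rearrange (sum (map (λ v → leaves v ∸ 1) βs)) (length bs) (length βs) ⟩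
    sum (map (λ v → leaves v ∸ 1) βs) + length βs * 1 + 2 * length bs
      -- Every branch in `βs` has a leaf on one of its legs, so `leaves v ∸ 1` is exact.
      ≤⟨ +-monoˡ-≤ (2 * length bs) (sum-shift-≥ 1 βs (λ v∈ → ≤-reflexive (m∸n+n≡m (βs-leaf v∈)))) ⟩
    sum (map leaves βs) + 2 * length bs
      -- By `onLeg-owner` no leaf is counted for two branches.
      ≤⟨ +-monoˡ-≤ (2 * length bs) (sum-fibres onLeg? ls (proj₁ enum-βs) (λ v∈ v′∈ → onLeg-owner (βs-branch v∈) (βs-branch v′∈))) ⟩
    length ls + 2 * length bs ∎
    where
    open ≤-Reasoning
    rearrange : ∀ a b c → a + b * 2 + c ≡ a + c * 1 + 2 * b
    rearrange = solve-∀
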